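{- Let $k_{1},\ldots,k_{r},l_{1},\ldots,l_{s}$ be positive integers. Then the equality \begin{align} &\text{\pounds}_{\widehat{\mathcal{A}},\alpha}\left(\begin{pmatrix}x_{1},\ldots,x_{r}\\ k_{1},\ldots,k_{r}\end{pmatrix}\mathbin{\sqcup\!\sqcup}\begin{pmatrix}y_{1},\ldots,y_{s}\\ l_{1},\ldots,l_{s}\end{pmatrix}\right)\\ &\qquad=(-1)^{l_{1}+\cdots+l_{s}}y_{1}^{\boldsymbol{p}}\sum_{f_{1},\ldots,f_{s}\ge 0}\left(\prod_{i=1}^{s}\binom{l_{i}+f_{i}-1}{f_{i}}\right)\text{\pounds}_{\widehat{\mathcal{A}},\alpha}\begin{pmatrix}x_{1}/y_{1},\ldots,x_{r}/y_{1},1/y_{1},y_{s}/y_{1},\ldots,y_{2}/y_{1}\\ k_{1},\ldots,k_{r},l_{s}+f_{s},\ldots,l_{1}+f_{1}\end{pmatrix}\boldsymbol{p}^{f_{1}+\cdots+f_{s}} \end{align} holds in $\widehat{\mathcal{A}}^{\mathcal{P}(N;\alpha)}_{\mathbb{Z}[\mathbf{x},y_{1},y_{1}^{ -1},y_{2},\ldots,y_{s}]}$.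
   Context: $x_{1},\ldots,x_{r},y_{1},\ldots,y_{s}$ are indeterminates, $\mathbf{x}=(x_{1},\ldots,x_{r})$, $N$ a positive integer, $\alpha\in\mathbb{Z}/N\mathbb{Z}$ and $\mathcal{P}(N;\alpha)$ the set of primes $p\equiv\alpha\pmod N$. For a commutative ring $R$ and $\Sigma\subseteq R$, $\mathcal{A}^{\Sigma}_{n,R}=(\prod_{a\in\Sigma}R/a^{n}R)/(\bigoplus_{a\in\Sigma}R/a^{n}R)$ and $\widehat{\mathcal{A}}^{\Sigma}_{R}=\varprojlim_{n}\mathcal{A}^{\Sigma}_{n,R}$, with natural projection $\pi^{\Sigma}_{R}\colon\prod_{a\in\Sigma}\varprojlim_{n}R/a^{n}R\to\widehat{\mathcal{A}}^{\Sigma}_{R}$; $\boldsymbol{p}$ is the image of $(p)_{p\in\mathcal{P}(N;\alpha)}$ and $y_{1}^{\boldsymbol{p}}$ the image of $(y_{1}^{p})_{p}$; the ring is $\boldsymbol{p}$-adically complete. For elements $a_{1},\ldots,a_{n}$ of the coefficient ring and positive integers $k_{i}$, $\text{\pounds}_{<M}\begin{pmatrix}a_{1},\ldots,a_{n}\\ k_{1},\ldots,k_{n}\end{pmatrix}=\sum_{0<m_{1}<\cdots<m_{n}<M}\frac{a_{1}^{m_{1}}a_{2}^{m_{2}-m_{1}}\cdots a_{n}^{m_{n}-m_{n-1}}}{m_{1}^{k_{1}}\cdots m_{n}^{k_{n}}}$ and $\text{\pounds}_{\widehat{\mathcal{A}},\alpha}$ of it is the image under $\pi$ of $(\text{\pounds}_{<p}(\cdot))_{p\in\mathcal{P}(N;\alpha)}$,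 extended $\mathbb{Q}$-linearly. The shuffle of such symbols is defined by identifying $\begin{pmatrix}a_{1},\ldots,a_{n}\\ k_{1},\ldots,k_{n}\end{pmatrix}$ with the word $\prod_{i}e_{a_{i}}e_{0}^{k_{i}-1}$ in the noncommutative polynomial ring over $\mathbb{Q}$ in letters $e_{0},e_{1},e_{x_{i}},e_{y_{j}}$, with shuffle product $1\mathbin{\sqcup\!\sqcup}w=w\mathbin{\sqcup\!\sqcup}1=w$, $we_{z}\mathbin{\sqcup\!\sqcup}w'e_{z'}=(we_{z}\mathbin{\sqcup\!\sqcup}w')e_{z'}+(w\mathbin{\sqcup\!\sqcup}w'e_{z'})e_{z}$, and converting back. -}

module Defs where

open import Data.Nat as ℕ using (ℕ; zero; suc; _∸_; _<_; _≤_; NonZero)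
open import Data.Nat.Divisibility using (_∣_)
open import Data.Nat.Primality using (Prime)
open import Data.Nat.DivMod using (_mod_)
open import Data.Nat.Combinatorics using (_C_)
open import Data.Integer as ℤ using (ℤ; +_; ∣_∣)
open import Data.Rational as ℚ using (ℚ; 0ℚ; 1ℚ; ↥_; ↧ₙ_)
open import Data.Fin as Fin using (Fin; _↑ˡ_; _↑ʳ_)
open import Data.List as List using (List; []; _∷_; _++_; [_]; map; concatMap; upTo; foldr; reverse; replicate)
open import Data.Vec as Vec using (Vec)
import Data.Vec.Properties as VecP
open import Data.Maybe using (Maybe; just; nothing)
open import Data.Product using (_×_; _,_; proj₁; proj₂; ∃-syntax)
open import Relation.Nullary using (¬_; yes; no)
open import Relation.Binary.PropositionalEquality using (_≡_)

-- Laurent monomials in nv variables: exponent vectors in ℤ^nv.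
-- Variables: x₁..x_R are indices (i ↑ˡ S), y₁..y_S are (R ↑ʳ j).

Mono : ℕ → Set
Mono nv = Vec ℤ nv

mono1 : ∀ {nv} → Mono nv
mono1 = Vec.replicate _ (+ 0)

monoMul : ∀ {nv} → Mono nv → Mono nv → Mono nv
monoMul = Vec.zipWith ℤ._+_

monoInv : ∀ {nv} → Mono nv → Mono nv
monoInv = Vec.map (λ e → ℤ.- e)

monoPow : ∀ {nv} → Mono nv → ℕ → Mono nv
monoPow a m = Vec.map (λ e → + m ℤ.* e) a

var : ∀ {nv} → Fin nv → Mono nv
var v = Vec.updateAt mono1 v (λ _ → + 1)

-- elements of Q[x, y₁^{±1}, y₂, …] as finite formal sums  Σ c·monomial
Poly : ℕ → Set
Poly nv = List (ℚ × Mono nv)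

scale : ∀ {nv} → ℚ → Mono nv → Poly nv → Poly nv
scale c a = map (λ t → (c ℚ.* proj₁ t , monoMul a (proj₂ t)))

coeff : ∀ {nv} → Mono nv → Poly nv → ℚ
coeff μ [] = 0ℚ
coeff μ ((c , ν) ∷ P) with VecP.≡-dec ℤ._≟_ ν μ
... | yes _ = c ℚ.+ coeff μ P
... | no  _ = coeff μ P

qpow : ℚ → ℕ → ℚ
qpow q zero = 1ℚ
qpow q (suc k) = q ℚ.* qpow q k

fromℕℚ : ℕ → ℚ
fromℕℚ n = + n ℚ./ 1

signℚ : ℕ → ℚ
signℚ zero = 1ℚ
signℚ (suc n) = ℚ.- signℚ n

Sym : ℕ → Set
Sym nv = List (Mono nv × ℕ)

-- Σ_{m0<m1<…<mn<M} a₁^{m1-m0} … aₙ^{mn-m(n-1)} / (m1^k1 … mn^kn)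
£go : ∀ {nv} → ℕ → Sym nv → ℕ → Poly nv
£go m0 [] M = [ (1ℚ , mono1) ]
£go m0 ((a , k) ∷ rest) M =
  concatMap
    (λ j → scale (qpow (+ 1 ℚ./ suc (m0 ℕ.+ j)) k)   -- 1 / m^k with m = m0+1+j
                 (monoPow a (suc j))                   -- a^(m - m0)
                 (£go (suc (m0 ℕ.+ j)) rest M))
    (upTo (M ∸ suc m0))

£< : ∀ {nv} → ℕ → Sym nv → Poly nv
£< M S = £go 0 S M

-- Shuffle product on words in letters e₀ (= nothing) and e_a (= just a).
-- Words are handled reversed, so that the recursion on the LAST letters
--   w e_z ⧢ w' e_z' = (w e_z ⧢ w') e_z' + (w ⧢ w' e_z') e_z
-- becomes recursion on list heads.  The result is a list of words
-- (a formal sum with multiplicities).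

Letter : ℕ → Set
Letter nv = Maybe (Mono nv)

shRev : ∀ {nv} → List (Letter nv) → List (Letter nv) → List (List (Letter nv))
shRev [] w' = [ w' ]
shRev (z ∷ w) [] = [ z ∷ w ]
shRev (z ∷ w) (z' ∷ w') =
  map (z' ∷_) (shRev (z ∷ w) w') ++ map (z ∷_) (shRev w (z' ∷ w'))

shuffleW : ∀ {nv} → List (Letter nv) → List (Letter nv) → List (List (Letter nv))
shuffleW u v = map reverse (shRev (reverse u) (reverse v))

toWord : ∀ {nv} → Sym nv → List (Letter nv)
toWord = concatMap (λ t → just (proj₁ t) ∷ replicate (proj₂ t ∸ 1) nothing)

fromWord : ∀ {nv} → List (Letter nv) → Sym nv
fromWord w = proj₂ (foldr step (0 , []) w)
  where
  step : _ → ℕ × Sym _ → ℕ × Sym _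
  step nothing  (z , S) = (suc z , S)
  step (just a) (z , S) = (0 , (a , suc z) ∷ S)

shuffleS : ∀ {nv} → Sym nv → Sym nv → List (Sym nv)
shuffleS S T = map fromWord (shuffleW (toWord S) (toWord T))

£<Σ : ∀ {nv} → ℕ → List (Sym nv) → Poly nv
£<Σ M = concatMap (£< M)

-- Equality in Â^{P(N;α)}_R, R = Z[x, y₁, y₁⁻¹, y₂, …, y_s].
-- A family F p n (p prime, n the level) represents, for each n, an
-- element of A_n = (Π_p R/p^n R)/(⊕_p R/p^n R) (the components have
-- p-integral rational coefficients, read in R/p^n R).  Two such elements
-- of Â = lim_n A_n agree iff for every n they agree in A_n, i.e. for all
-- but finitely many p ∈ P(N;α) the difference lies in p^n Z_(p)[...].

InPPow : ℕ → ℕ → ℚ → Set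
InPPow p n q = (p ℕ.^ n) ∣ ∣ ↥ q ∣ × ¬ (p ∣ ↧ₙ q)

CongPPow : ∀ {nv} → ℕ → ℕ → Poly nv → Poly nv → Set
CongPPow p n P Q = ∀ μ → InPPow p n (coeff μ P ℚ.- coeff μ Q)

EqÂ : ∀ {nv} (N : ℕ) .{{_ : NonZero N}} → Fin N →
      (ℕ → ℕ → Poly nv) → (ℕ → ℕ → Poly nv) → Set
EqÂ N α F G = ∀ n → ∃[ B ] ∀ p → Prime p → p mod N ≡ α → B < p →
              CongPPow p n (F p n) (G p n)

module _ (r' s' : ℕ) where
  nv : ℕ
  nv = suc r' ℕ.+ suc s'

  xv : Fin (suc r') → Mono nv
  xv i = var (i ↑ˡ suc s')

  yv : Fin (suc s') → Mono nv
  yv j = var (suc r' ↑ʳ j)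

  y₁⁻¹ : Mono nv
  y₁⁻¹ = monoInv (yv Fin.zero)

  symX : (Fin (suc r') → ℕ) → Sym nv
  symX k = List.tabulate (λ i → (xv i , k i))

  symY : (Fin (suc s') → ℕ) → Sym nv
  symY l = List.tabulate (λ j → (yv j , l j))

  LHS : (Fin (suc r') → ℕ) → (Fin (suc s') → ℕ) → ℕ → ℕ → Poly nv
  LHS k l p n = £<Σ p (shuffleS (symX k) (symY l))

  symRHS : (Fin (suc r') → ℕ) → (Fin (suc s') → ℕ) → (Fin (suc s') → ℕ) → Sym nv
  symRHS k l f =
    List.tabulate (λ i → (monoMul (xv i) y₁⁻¹ , k i))
    ++ Vec.toList (Vec.zip
         (y₁⁻¹ Vec.∷ Vec.reverse (Vec.tabulate (λ j → monoMul (yv (Fin.suc j)) y₁⁻¹)))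
         (Vec.reverse (Vec.tabulate (λ j → l j ℕ.+ f j))))

  box : (m n : ℕ) → List (Vec ℕ m)
  box zero n = [ Vec.[] ]
  box (suc m) n = concatMap (λ v → map (Vec._∷ v) (upTo n)) (box m n)

  sumℕ : ∀ {m} → Vec ℕ m → ℕ
  sumℕ = Vec.foldr _ ℕ._+_ 0

  binomProd : (Fin (suc s') → ℕ) → (Fin (suc s') → ℕ) → ℚ
  binomProd l f = Vec.foldr _ ℚ._*_ 1ℚ
    (Vec.tabulate (λ i → fromℕℚ ((l i ℕ.+ f i ∸ 1) C f i)))

  -- image in A_n of the p-adically convergent right-hand side:
  -- terms with f₁+…+f_s ≥ n vanish mod p^n, so the sum is truncated
  -- to the finite box f_i < n (which contains all f with Σ f_i < n).
  RHS : (Fin (suc r') → ℕ) → (Fin (suc s') → ℕ) → ℕ → ℕ → Poly nv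
  RHS k l p n =
    scale (signℚ (Vec.foldr _ ℕ._+_ 0 (Vec.tabulate l)))
          (monoPow (yv Fin.zero) p)
          (concatMap
             (λ fv → let f = Vec.lookup fv in
                     scale (binomProd l f ℚ.* qpow (fromℕℚ p) (sumℕ fv))
                           mono1
                           (£< p (symRHS k l f)))
             (box (suc s') n))

{-# OPTIONS --safe #-}

-- Work over a fixed prime p. The generating series in t of the nested sums with outermost index m is obtained from 1
-- by multiplications by a t / (1 - a t) and divisions by the Euler derivation t d/dt, one for each letter of the word.
-- By Leibniz's rule the shuffle of two words corresponds to the Cauchy product of their series, so the left-hand side
-- is the sum of F_X(i) F_Y(j) over i + j < p. Substituting m ↦ p - m for the indices of the y-sum turns it into a
-- nested sum whose indices lie above i, with denominators p - m; expanding (p - m)^(-l) in powers of p and moving the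
-- factor y₁^(p - m) outside gives the right-hand side.

module Submission where

open import Defs
open import Algebra using (CommutativeRing)
open import Data.Empty using (⊥)
open import Data.Fin using (Fin)
import Data.Fin as Fin
open import Data.Integer.Base as ℤ using (+_; ∣_∣)
open import Data.Integer.GCD using (gcd; gcd[i,j]∣j)
import Data.Integer.Properties as ℤ
open import Data.List.Base as List
  using (List; []; _∷_; _++_; [_]; map; concatMap; upTo; applyUpTo; foldr; foldl; reverse; replicate)
import Data.List.Properties as List
open import Data.List.Relation.Unary.All as All using (All; []; _∷_)
import Data.List.Relation.Unary.All.Properties as All
open import Data.Maybe.Base using (just; nothing)
open import Data.Nat as ℕ using (ℕ; zero; suc; NonZero; _∸_; _<_; _≤_; z<s; s<s; z≤n; s≤s)
open import Data.Nat.Combinatorics using (_C_; nCk+nC[k+1]≡[n+1]C[k+1]; k>n⇒nCk≡0)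
open import Data.Nat.Divisibility as ℕ using (_∣_; divides)
open import Data.Nat.Primality using (Prime; euclidsLemma; prime⇒nonZero; prime⇒nonTrivial)
import Data.Nat.Properties as ℕ
open import Data.Product using (_×_; _,_; proj₁; proj₂; ∃-syntax)
open import Data.Rational.Base as ℚ using (ℚ; 0ℚ; 1ℚ; ↥_; ↧_; ↧ₙ_; toℚᵘ)
import Data.Rational.Properties as ℚ
open import Data.Rational.Solver using (module +-*-Solver)
import Data.Rational.Unnormalised.Base as ℚᵘ
import Data.Rational.Unnormalised.Properties as ℚᵘ
open import Data.Sum.Base using ([_,_]′; inj₁; inj₂)
open import Data.Unit using (⊤; tt)
open import Data.Vec.Base as Vec using (Vec; []; _∷_)
import Data.Vec.Properties as Vec
open import Function using (_∘_; id; flip)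
open import Level as Level using (0ℓ; _⊔_)
open import Relation.Binary.PropositionalEquality as ≡ using (_≡_)
open import Relation.Nullary using (¬_; yes; no)

-- Dividing by every index forces the ambient ring to be a ℚ-algebra, and there p^n divides
-- everything. Equality and congruence are therefore kept apart: all steps up to and including the
-- reflection are exact identities, and only the expansion of (p - m)^(-l) is a congruence, measured
-- in a subring of p-integral elements. Every index lies strictly between 0 and p, so every
-- denominator is prime to p, and no prime has to be excepted. The entry 1/y₁ on the right-hand side
-- has its origin in the condition i + j < p: between i and the reflected top index p - j it is a
-- gap of base 1. The gap below the lowest y-index turns into the gap up to p, which is why y₁ alone
-- has to be invertible; pulling out y₁^p leaves a power of 1/y₁ that telescopes over the gaps and
-- divides every base by y₁, the base 1 included. Leibniz's rule says nothing about constant terms,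
-- and t d/dt cannot be inverted on them. This is harmless as long as no word begins with e₀;
-- exactly these words are also the ones that convert back to symbols without loss. The condition
-- has to be carried through the shuffle recursion.

module Sequences {c ℓ} (R : CommutativeRing c ℓ) where
  open CommutativeRing R
  open import Algebra.Properties.Semiring.Exp semiring public using (_^_; ^-congˡ; ^-homo-*)
  open import Algebra.Properties.Semiring.Mult semiring using () renaming (_×_ to _·_)
  open import Algebra.Solver.Ring.NaturalCoefficients.Default commutativeSemiring
    public using (solve; _:=_; _:+_; _:*_; con)
  open import Relation.Binary.Reasoning.Setoid setoid

  -- Finite sums and sequences over a commutative ring

  Seq : Set c
  Seq = ℕ → Carrier

  infix 4 _≐_
  _≐_ : Seq → Seq → Set ℓ
  f ≐ g = ∀ m → f m ≈ g m

  nat : ℕ → Carrier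
  nat n = n · 1#

  ∑< : ℕ → Seq → Carrier
  ∑< zero    f = 0#
  ∑< (suc n) f = f 0 + ∑< n (f ∘ suc)

  ∑<-cong : ∀ n {f g} → (∀ j → j < n → f j ≈ g j) → ∑< n f ≈ ∑< n g
  ∑<-cong zero    e = refl
  ∑<-cong (suc n) e = +-cong (e 0 z<s) (∑<-cong n λ j j<n → e (suc j) (s<s j<n))

  ∑<-zero : ∀ n → ∑< n (λ _ → 0#) ≈ 0#
  ∑<-zero zero    = refl
  ∑<-zero (suc n) = trans (+-identityˡ _) (∑<-zero n)

  ∑<-+ : ∀ n f g → ∑< n (λ j → f j + g j) ≈ ∑< n f + ∑< n g
  ∑<-+ zero    f g = sym (+-identityˡ 0#)
  ∑<-+ (suc n) f g = trans (+-congˡ (∑<-+ n (f ∘ suc) (g ∘ suc)))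
    (solve 4 (λ a b x y → (a :+ b) :+ (x :+ y) := (a :+ x) :+ (b :+ y)) refl
      (f 0) (g 0) (∑< n (f ∘ suc)) (∑< n (g ∘ suc)))

  *-∑< : ∀ n a f → a * ∑< n f ≈ ∑< n (λ j → a * f j)
  *-∑< zero    a f = zeroʳ a
  *-∑< (suc n) a f = trans (distribˡ a _ _) (+-congˡ (*-∑< n a (f ∘ suc)))

  ∑<-last : ∀ n f → ∑< (suc n) f ≈ ∑< n f + f n
  ∑<-last zero    f = +-comm _ _
  ∑<-last (suc n) f = trans (+-congˡ (∑<-last n (f ∘ suc))) (sym (+-assoc _ _ _))

  ∑ : ∀ {a} {A : Set a} → List A → (A → Carrier) → Carrier
  ∑ xs f = foldr (λ x s → f x + s) 0# xs

  module _ {a} {A : Set a} where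

    ∑-cong : ∀ (xs : List A) {f g} → (∀ x → f x ≈ g x) → ∑ xs f ≈ ∑ xs g
    ∑-cong []       e = refl
    ∑-cong (x ∷ xs) e = +-cong (e x) (∑-cong xs e)

    ∑-++ : ∀ (xs ys : List A) f → ∑ (xs ++ ys) f ≈ ∑ xs f + ∑ ys f
    ∑-++ []       ys f = sym (+-identityˡ _)
    ∑-++ (x ∷ xs) ys f = trans (+-congˡ (∑-++ xs ys f)) (sym (+-assoc _ _ _))

    *-∑ : ∀ (xs : List A) b f → b * ∑ xs f ≈ ∑ xs (λ x → b * f x)
    *-∑ []       b f = zeroʳ b
    *-∑ (x ∷ xs) b f = trans (distribˡ b _ _) (+-congˡ (*-∑ xs b f))

    ∑-+ : ∀ (xs : List A) f g → ∑ xs (λ x → f x + g x) ≈ ∑ xs f + ∑ xs g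
    ∑-+ []       f g = sym (+-identityˡ 0#)
    ∑-+ (x ∷ xs) f g = trans (+-congˡ (∑-+ xs f g))
      (solve 4 (λ a b x y → (a :+ b) :+ (x :+ y) := (a :+ x) :+ (b :+ y)) refl
        (f x) (g x) (∑ xs f) (∑ xs g))

    ∑-zero : ∀ (xs : List A) → ∑ xs (λ _ → 0#) ≈ 0#
    ∑-zero []       = refl
    ∑-zero (x ∷ xs) = trans (+-identityˡ _) (∑-zero xs)

    ∑<-∑ : ∀ n (xs : List A) (f : ℕ → A → Carrier) → ∑< n (λ j → ∑ xs (f j)) ≈ ∑ xs (λ x → ∑< n (λ j → f j x))
    ∑<-∑ zero    xs f = sym (∑-zero xs)
    ∑<-∑ (suc n) xs f = trans (+-congˡ (∑<-∑ n xs (f ∘ suc))) (sym (∑-+ xs (f 0) _))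

    ∑-map : ∀ {b} {B : Set b} (h : B → A) xs f → ∑ (map h xs) f ≈ ∑ xs (f ∘ h)
    ∑-map h []       f = refl
    ∑-map h (x ∷ xs) f = +-congˡ (∑-map h xs f)

    ∑-concatMap : ∀ {b} {B : Set b} (h : B → List A) xs f →
                  ∑ (concatMap h xs) f ≈ ∑ xs (λ x → ∑ (h x) f)
    ∑-concatMap h []       f = refl
    ∑-concatMap h (x ∷ xs) f = trans (∑-++ (h x) _ f) (+-congˡ (∑-concatMap h xs f))

    ∑-applyUpTo : ∀ (h : ℕ → A) n f → ∑ (applyUpTo h n) f ≈ ∑< n (f ∘ h)
    ∑-applyUpTo h zero    f = refl
    ∑-applyUpTo h (suc n) f = +-congˡ (∑-applyUpTo (h ∘ suc) n f)

  collect-scalars : ∀ {a} {A : Set a} (xs : List A) s y (b q S : A → Carrier) →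
    s * (y * ∑ xs (λ x → (b x * q x) * (1# * S x))) ≈ ∑ xs (λ x → (s * (b x * q x)) * (y * S x))
  collect-scalars xs s y b q S = begin
    s * (y * ∑ xs (λ x → (b x * q x) * (1# * S x)))     ≈⟨ *-congˡ (*-∑ xs y _) ⟩
    s * ∑ xs (λ x → y * ((b x * q x) * (1# * S x)))     ≈⟨ *-∑ xs s _ ⟩
    ∑ xs (λ x → s * (y * ((b x * q x) * (1# * S x))))   ≈⟨ ∑-cong xs (λ x →
      solve 4 (λ s y t n → s :* (y :* (t :* (con 1 :* n))) := (s :* t) :* (y :* n)) refl s y (b x * q x) (S x)) ⟩
    ∑ xs (λ x → (s * (b x * q x)) * (y * S x))          ∎

  -- On generating series: multiplication by a t / (1 - a t).
  D : Carrier → Seq → Seq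
  D a v zero    = 0#
  D a v (suc m) = a * (D a v m + v m)

  D-cong : ∀ {a b f g} → a ≈ b → f ≐ g → D a f ≐ D b g
  D-cong a≈b e zero    = refl
  D-cong a≈b e (suc m) = *-cong a≈b (+-cong (D-cong a≈b e m) (e m))

  D-+ : ∀ a f g → D a (λ m → f m + g m) ≐ (λ m → D a f m + D a g m)
  D-+ a f g zero    = sym (+-identityˡ 0#)
  D-+ a f g (suc m) = trans (*-congˡ (+-congʳ (D-+ a f g m)))
    (solve 5 (λ a x y u v → a :* ((x :+ y) :+ (u :+ v)) := a :* (x :+ u) :+ a :* (y :+ v)) refl
      a (D a f m) (D a g m) (f m) (g m))

  D-* : ∀ a b f → D a (λ m → b * f m) ≐ (λ m → b * D a f m)
  D-* a b f zero    = sym (zeroʳ b)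
  D-* a b f (suc m) = trans (*-congˡ (+-congʳ (D-* a b f m)))
    (solve 4 (λ a b x u → a :* (b :* x :+ b :* u) := b :* (a :* (x :+ u))) refl
      a b (D a f m) (f m))

  D-0 : ∀ a → D a (λ _ → 0#) ≐ (λ _ → 0#)
  D-0 a zero    = refl
  D-0 a (suc m) = trans (*-congˡ (trans (+-identityʳ _) (D-0 a m))) (zeroʳ a)

  D-suc : ∀ a v m → D a v (suc m) ≈ a ^ suc m * v 0 + D a (v ∘ suc) m
  D-suc a v zero    = solve 2 (λ a x → a :* (con 0 :+ x) := (a :* con 1) :* x :+ con 0) refl a (v 0)
  D-suc a v (suc m) = trans (*-congˡ (+-congʳ (D-suc a v m)))
    (solve 5 (λ a p x y z → a :* ((p :* x :+ y) :+ z) := (a :* p) :* x :+ a :* (y :+ z)) refl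
      a (a ^ suc m) (v 0) (D a (v ∘ suc) m) (v (suc m)))

  D1≈∑< : ∀ v m → D 1# v m ≈ ∑< m v
  D1≈∑< v zero    = refl
  D1≈∑< v (suc m) = trans (*-identityˡ _) (trans (+-congʳ (D1≈∑< v m)) (sym (∑<-last m v)))

  -- Written from the top index downwards, the convolution is ready for the reflection of indices.
  -- Its lowest term would be the one at `v 0`, which the hypothesis removes.
  D-as-∑< : ∀ a v → v 0 ≈ 0# → ∀ q → D a v (suc q) ≈ ∑< q (λ j → a ^ suc j * v (q ∸ j))
  D-as-∑< a v v0 zero    = trans (*-congˡ (trans (+-identityˡ _) v0)) (zeroʳ a)
  D-as-∑< a v v0 (suc q) = begin
    a * (D a v (suc q) + v (suc q))
      ≈⟨ *-congˡ (+-congʳ (D-as-∑< a v v0 q)) ⟩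
    a * (∑< q (λ j → a ^ suc j * v (q ∸ j)) + v (suc q))
      ≈⟨ solve 3 (λ a s x → a :* (s :+ x) := (a :* con 1) :* x :+ a :* s) refl a _ _ ⟩
    (a * 1#) * v (suc q) + a * ∑< q (λ j → a ^ suc j * v (q ∸ j))
      ≈⟨ +-congˡ (trans (*-∑< q a _) (∑<-cong q λ j _ → sym (*-assoc _ _ _))) ⟩
    (a * 1#) * v (suc q) + ∑< q (λ j → a ^ suc (suc j) * v (q ∸ j)) ∎

  -- Cauchy product and Euler derivation

  infixl 7 _⋆_
  _⋆_ : Seq → Seq → Seq
  (f ⋆ g) zero    = f 0 * g 0
  (f ⋆ g) (suc m) = f 0 * g (suc m) + (f ∘ suc ⋆ g) m

  ⋆-cong : ∀ {f f′ g g′} → f ≐ f′ → g ≐ g′ → f ⋆ g ≐ f′ ⋆ g′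
  ⋆-cong e e′ zero    = *-cong (e 0) (e′ 0)
  ⋆-cong e e′ (suc m) = +-cong (*-cong (e 0) (e′ (suc m))) (⋆-cong (e ∘ suc) e′ m)

  ⋆-distribʳ : ∀ f f′ g → (λ m → f m + f′ m) ⋆ g ≐ (λ m → (f ⋆ g) m + (f′ ⋆ g) m)
  ⋆-distribʳ f f′ g zero    = distribʳ _ _ _
  ⋆-distribʳ f f′ g (suc m) = trans (+-congˡ (⋆-distribʳ (f ∘ suc) (f′ ∘ suc) g m))
    (solve 5 (λ a b x y z → (a :+ b) :* x :+ (y :+ z) := (a :* x :+ y) :+ (b :* x :+ z)) refl
      (f 0) (f′ 0) (g (suc m)) ((f ∘ suc ⋆ g) m) ((f′ ∘ suc ⋆ g) m))

  ⋆-suc : ∀ f g m → (f ⋆ g) (suc m) ≈ (f ⋆ (g ∘ suc)) m + f (suc m) * g 0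
  ⋆-suc f g zero    = refl
  ⋆-suc f g (suc m) = trans (+-congˡ (⋆-suc (f ∘ suc) g m)) (sym (+-assoc _ _ _))

  ⋆-comm : ∀ f g → f ⋆ g ≐ g ⋆ f
  ⋆-comm f g zero    = *-comm _ _
  ⋆-comm f g (suc m) = begin
    f 0 * g (suc m) + (f ∘ suc ⋆ g) m ≈⟨ +-cong (*-comm _ _) (⋆-comm (f ∘ suc) g m) ⟩
    g (suc m) * f 0 + (g ⋆ f ∘ suc) m ≈⟨ +-comm _ _ ⟩
    (g ⋆ f ∘ suc) m + g (suc m) * f 0 ≈⟨ ⋆-suc g f m ⟨
    (g ⋆ f) (suc m)                   ∎

  -- Multiplication by a fixed series is linear over the Cauchy product. The induction splits off
  -- the first coefficient of `f`; `D-suc` isolates what `g 0` contributes, and this completes the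
  -- coefficient of `f 0`.
  D-⋆ʳ : ∀ a f g → D a (f ⋆ g) ≐ f ⋆ D a g
  D-⋆ʳ a f g zero    = sym (zeroʳ _)
  D-⋆ʳ a f g (suc m) = begin
    D a (f ⋆ g) (suc m)
      ≈⟨ D-suc a (f ⋆ g) m ⟩
    a ^ suc m * (f 0 * g 0) + D a (λ i → f 0 * g (suc i) + (f ∘ suc ⋆ g) i) m
      ≈⟨ +-congˡ (trans (D-+ a _ _ m) (+-cong (D-* a (f 0) (g ∘ suc) m) (D-⋆ʳ a (f ∘ suc) g m))) ⟩
    a ^ suc m * (f 0 * g 0) + (f 0 * D a (g ∘ suc) m + (f ∘ suc ⋆ D a g) m)
      ≈⟨ solve 5 (λ p x y d s → p :* (x :* y) :+ (x :* d :+ s) := x :* (p :* y :+ d) :+ s) refl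
           (a ^ suc m) (f 0) (g 0) (D a (g ∘ suc) m) ((f ∘ suc ⋆ D a g) m) ⟩
    f 0 * (a ^ suc m * g 0 + D a (g ∘ suc) m) + (f ∘ suc ⋆ D a g) m
      ≈⟨ +-congʳ (*-congˡ (D-suc a g m)) ⟨
    f 0 * D a g (suc m) + (f ∘ suc ⋆ D a g) m ∎

  D-⋆ˡ : ∀ a f g → D a (f ⋆ g) ≐ D a f ⋆ g
  D-⋆ˡ a f g m = begin
    D a (f ⋆ g) m ≈⟨ D-cong refl (⋆-comm f g) m ⟩
    D a (g ⋆ f) m ≈⟨ D-⋆ʳ a g f m ⟩
    (g ⋆ D a f) m ≈⟨ ⋆-comm g (D a f) m ⟩
    (D a f ⋆ g) m ∎

  θ : Seq → Seq
  θ f m = nat m * f m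

  θ-⋆ : ∀ f g → θ (f ⋆ g) ≐ (λ m → (θ f ⋆ g) m + (f ⋆ θ g) m)
  θ-⋆ f g zero    = solve 2 (λ x y → con 0 :* (x :* y) := (con 0 :* x) :* y :+ x :* (con 0 :* y)) refl
                      (f 0) (g 0)
  θ-⋆ f g (suc m) = begin
    (1# + nat m) * (f 0 * g (suc m) + (f ∘ suc ⋆ g) m)
      ≈⟨ solve 4 (λ n x y s → (con 1 :+ n) :* (x :* y :+ s) :=
                   (con 0 :* x) :* y :+ (x :* ((con 1 :+ n) :* y) :+ (s :+ n :* s))) refl
           (nat m) (f 0) (g (suc m)) ((f ∘ suc ⋆ g) m) ⟩
    (0# * f 0) * g (suc m) + (f 0 * ((1# + nat m) * g (suc m)) + ((f ∘ suc ⋆ g) m + θ (f ∘ suc ⋆ g) m))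
      ≈⟨ +-congˡ (+-congˡ (+-congˡ (θ-⋆ (f ∘ suc) g m))) ⟩
    (0# * f 0) * g (suc m) + (f 0 * ((1# + nat m) * g (suc m)) +
      ((f ∘ suc ⋆ g) m + ((θ (f ∘ suc) ⋆ g) m + (f ∘ suc ⋆ θ g) m)))
      ≈⟨ solve 5 (λ a b s t u → a :+ (b :+ (s :+ (t :+ u))) := (a :+ (s :+ t)) :+ (b :+ u)) refl _ _ _ _ _ ⟩
    ((0# * f 0) * g (suc m) + ((f ∘ suc ⋆ g) m + (θ (f ∘ suc) ⋆ g) m)) +
      (f 0 * ((1# + nat m) * g (suc m)) + (f ∘ suc ⋆ θ g) m)
      -- Shifting lowers the weight of each coefficient by one, so `θ f ∘ suc` is `θ (f ∘ suc)` plus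
      -- one further copy of `f ∘ suc`.
      ≈⟨ +-congʳ (+-congˡ (sym (trans
           (⋆-cong {g = g} (λ i → trans (distribʳ (f (suc i)) 1# (nat i)) (+-congʳ (*-identityˡ _))) (λ _ → refl) m)
           (⋆-distribʳ (f ∘ suc) (θ (f ∘ suc)) g m)))) ⟩
    (θ f ⋆ g) (suc m) + (f ⋆ θ g) (suc m) ∎

  ⋆-as-∑< : ∀ f g → g 0 ≈ 0# → ∀ m → (f ⋆ g) m ≈ ∑< m (λ i → f i * g (m ∸ i))
  ⋆-as-∑< f g g0 zero    = trans (*-congˡ g0) (zeroʳ _)
  ⋆-as-∑< f g g0 (suc m) = +-congˡ (⋆-as-∑< (f ∘ suc) g g0 m)

  -- Summing the coefficients below `m` is multiplication by t / (1 - t), and this factor may be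
  -- attached to `g` alone. The base 1 introduced here later becomes the entry 1/y₁.
  ∑<-⋆ : ∀ f g m → ∑< m (f ⋆ g) ≈ ∑< m (λ i → f i * D 1# g (m ∸ i))
  ∑<-⋆ f g m = begin
    ∑< m (f ⋆ g)                     ≈⟨ D1≈∑< (f ⋆ g) m ⟨
    D 1# (f ⋆ g) m                   ≈⟨ D-⋆ʳ 1# f g m ⟩
    (f ⋆ D 1# g) m                   ≈⟨ ⋆-as-∑< f (D 1# g) refl m ⟩
    ∑< m (λ i → f i * D 1# g (m ∸ i)) ∎

  δ : Seq
  δ zero    = 1#
  δ (suc _) = 0#

  ⋆-identityʳ : ∀ f → f ⋆ δ ≐ f
  ⋆-identityʳ f zero    = *-identityʳ _
  ⋆-identityʳ f (suc m) = trans (+-cong (zeroʳ _) (⋆-identityʳ (f ∘ suc) m)) (+-identityˡ _)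

  ⋆-identityˡ : ∀ f → δ ⋆ f ≐ f
  ⋆-identityˡ f m = trans (⋆-comm δ f m) (⋆-identityʳ f m)

  -- Both sides are the sum of v(m) a^(b-m) g(b) over m < b < n, ordered once by the lower index and
  -- once by the upper. This is the passage between nested sums, built from the inside out, and
  -- series, built from the lowest index up.
  ∑<-D : ∀ a v g n → ∑< n (λ m → v m * ∑< (n ∸ suc m) (λ j → a ^ suc j * g (suc (m ℕ.+ j))))
                     ≈ ∑< n (λ m → D a v m * g m)
  ∑<-D a v g zero    = refl
  ∑<-D a v g (suc n) = begin
    v 0 * ∑< n (λ j → a ^ suc j * g (suc j)) +
      ∑< n (λ m → v (suc m) * ∑< (n ∸ suc m) (λ j → a ^ suc j * g (suc (suc (m ℕ.+ j)))))
      ≈⟨ +-cong (trans (*-∑< n (v 0) _) (∑<-cong n λ j _ → trans (sym (*-assoc _ _ _)) (*-congʳ (*-comm _ _))))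
                (∑<-D a (v ∘ suc) (g ∘ suc) n) ⟩
    ∑< n (λ j → (a ^ suc j * v 0) * g (suc j)) + ∑< n (λ j → D a (v ∘ suc) j * g (suc j))
      ≈⟨ ∑<-+ n _ _ ⟨
    ∑< n (λ j → (a ^ suc j * v 0) * g (suc j) + D a (v ∘ suc) j * g (suc j))
      ≈⟨ ∑<-cong n (λ j _ → trans (sym (distribʳ _ _ _)) (*-congʳ (sym (D-suc a v j)))) ⟩
    ∑< n (λ j → D a v (suc j) * g (suc j))
      ≈⟨ trans (+-congʳ (zeroˡ (g 0))) (+-identityˡ _) ⟨
    0# * g 0 + ∑< n (λ j → D a v (suc j) * g (suc j)) ∎

-- The abstract setting: inverses of integers, monomials, integral elements

module _ {c ℓ} (R : CommutativeRing c ℓ) where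
  open CommutativeRing R
  open Sequences R using (nat)

  -- inv m is 1/m, with the junk value inv 0 = 0.
  record Evaluation (nv : ℕ) : Set (c ⊔ ℓ) where
    field
      ⟦_⟧       : Mono nv → Carrier
      ⟦mono1⟧   : ⟦ mono1 ⟧ ≈ 1#
      ⟦monoMul⟧ : ∀ a b → ⟦ monoMul a b ⟧ ≈ ⟦ a ⟧ * ⟦ b ⟧
      inv       : ℕ → Carrier
      inv-0     : inv 0 ≈ 0#
      nat*inv   : ∀ m → nat (suc m) * inv (suc m) ≈ 1#

  -- A subring, in the application the polynomials that are integral at p. Without it a congruence
  -- modulo p^n would be empty, since p is invertible in the ambient ring.
  record IntegralElements : Set (c ⊔ Level.suc ℓ) where
    field
      Int      : Carrier → Set ℓ
      Int-resp : ∀ {x y} → x ≈ y → Int x → Int y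
      Int-0    : Int 0#
      Int-1    : Int 1#
      Int-+    : ∀ {x y} → Int x → Int y → Int (x + y)
      Int-*    : ∀ {x y} → Int x → Int y → Int (x * y)
      Int-neg  : ∀ {x} → Int x → Int (- x)

-- Words, symbols, and the conversion between them

module _ {nv : ℕ} where

  -- Words here are reversed: the head is the last letter, as in shRev.
  Admissible : List (Letter nv) → Set
  Admissible []                 = ⊤
  Admissible (just a  ∷ w)      = Admissible w
  Admissible (nothing ∷ [])     = ⊥
  Admissible (nothing ∷ z ∷ w)  = Admissible (z ∷ w)

  admissible-∷ : ∀ z z′ w → Admissible (z′ ∷ w) → Admissible (z ∷ z′ ∷ w)
  admissible-∷ (just a) z′ w A = A
  admissible-∷ nothing  z′ w A = A

  admissible-tail : ∀ z w → Admissible (z ∷ w) → Admissible w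
  admissible-tail (just a) w       A = A
  admissible-tail nothing  (_ ∷ _) A = A

  ∷-≢[] : ∀ {z} {w : List (Letter nv)} → z ∷ w ≡.≢ []
  ∷-≢[] ()

  -- Nonemptiness has to accompany admissibility: attaching e₀ to the empty word is the only way in
  -- which attaching a letter loses admissibility.
  AdmissibleNonEmpty : List (Letter nv) → Set
  AdmissibleNonEmpty u = Admissible u × u ≡.≢ []

  ∷-admissible : ∀ z {us} → All AdmissibleNonEmpty us → All AdmissibleNonEmpty (map (z ∷_) us)
  ∷-admissible z []                               = []
  ∷-admissible z {[] ∷ us}      ((_ , ne) ∷ As) with () ← ne ≡.refl
  ∷-admissible z {(z′ ∷ u) ∷ us} ((A , _) ∷ As) = (admissible-∷ z z′ u A , ∷-≢[]) ∷ ∷-admissible z As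

  shRev-admissible : ∀ z w z′ w′ → Admissible (z ∷ w) → Admissible (z′ ∷ w′) →
                     All AdmissibleNonEmpty (shRev (z ∷ w) (z′ ∷ w′))
  shRev-admissibleˡ : ∀ w z′ w′ → Admissible w → Admissible (z′ ∷ w′) →
                      All AdmissibleNonEmpty (shRev w (z′ ∷ w′))
  shRev-admissibleʳ : ∀ z w w′ → Admissible (z ∷ w) → Admissible w′ →
                      All AdmissibleNonEmpty (shRev (z ∷ w) w′)
  shRev-admissible z w z′ w′ A A′ = All.++⁺
    (∷-admissible z′ (shRev-admissibleʳ z w w′ A (admissible-tail z′ w′ A′)))
    (∷-admissible z (shRev-admissibleˡ w z′ w′ (admissible-tail z w A) A′))
  shRev-admissibleˡ []      z′ w′ A A′ = (A′ , ∷-≢[]) ∷ []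
  shRev-admissibleˡ (z ∷ w) z′ w′ A A′ = shRev-admissible z w z′ w′ A A′
  shRev-admissibleʳ z w []        A A′ = (A , ∷-≢[]) ∷ []
  shRev-admissibleʳ z w (z′ ∷ w′) A A′ = shRev-admissible z w z′ w′ A A′

  shuffles-admissible : ∀ u u′ → Admissible u → u ≡.≢ [] → Admissible u′ → u′ ≡.≢ [] →
                        All AdmissibleNonEmpty (shRev u u′)
  shuffles-admissible []      _         A ne A′ ne′ with () ← ne ≡.refl
  shuffles-admissible (_ ∷ _) []        A ne A′ ne′ with () ← ne′ ≡.refl
  shuffles-admissible (z ∷ w) (z′ ∷ w′) A ne A′ ne′ = shRev-admissible z w z′ w′ A A′

  symbol-reverse-admissible : ∀ (S : Sym nv) → Admissible (reverse (toWord S))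
  symbol-reverse-admissible S = go S [] _
    where
    go : ∀ (S : Sym nv) w → Admissible w → Admissible (toWord S List.ʳ++ w)
    letters : ∀ n (S : Sym nv) w → Admissible w → w ≡.≢ [] →
              Admissible ((replicate n nothing ++ toWord S) List.ʳ++ w)
    go []            w A = A
    go ((a , k) ∷ S) w A = letters (k ∸ 1) S (just a ∷ w) A ∷-≢[]
    letters zero    S w       A ne = go S w A
    letters (suc n) S []      A ne with () ← ne ≡.refl
    letters (suc n) S (z ∷ w) A ne = letters n S (nothing ∷ z ∷ w) A ∷-≢[]

  -- The parser local to `fromWord` enters through its two defining equations. Its counter `z` is
  -- the number of letters e₀ at the front of the part read so far, which no e_a has yet absorbed.
  toWord∘parse : (step : Letter nv → ℕ × Sym nv → ℕ × Sym nv) →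
    (∀ z S → step nothing (z , S) ≡ (suc z , S)) →
    (∀ a z S → step (just a) (z , S) ≡ (0 , (a , suc z) ∷ S)) →
    ∀ w → let (z , S) = foldr step (0 , []) w in w ≡ replicate z nothing ++ toWord S
  toWord∘parse step e e′ []            = ≡.refl
  toWord∘parse step e e′ (nothing ∷ w)
    rewrite e (proj₁ (foldr step (0 , []) w)) (proj₂ (foldr step (0 , []) w)) =
      ≡.cong (nothing ∷_) (toWord∘parse step e e′ w)
  toWord∘parse step e e′ (just a ∷ w)
    rewrite e′ a (proj₁ (foldr step (0 , []) w)) (proj₂ (foldr step (0 , []) w)) =
      ≡.cong (just a ∷_) (toWord∘parse step e e′ w)

  toWord∘fromWord-upto-nothings : ∀ w → ∃[ n ] w ≡ replicate n nothing ++ toWord (fromWord w)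
  toWord∘fromWord-upto-nothings w = _ , toWord∘parse _ (λ _ _ → ≡.refl) (λ _ _ _ → ≡.refl) w

  -- Parsing forgets nothing but leading letters e₀, and a word that begins with e_a has none.
  toWord∘fromWord : ∀ a w → toWord (fromWord (just a ∷ w)) ≡ just a ∷ w
  toWord∘fromWord a w with toWord∘fromWord-upto-nothings (just a ∷ w)
  ... | zero , e = ≡.sym e

  -- The bottom letter of an admissible reversed word is some e_a, and reversal brings it to the
  -- front.
  head-just : ∀ u → Admissible u → u ≡.≢ [] → ∀ w → ∃[ a ] ∃[ w′ ] u List.ʳ++ w ≡ just a ∷ w′
  head-just []                  A ne w with () ← ne ≡.refl
  head-just (just a ∷ [])       A ne w = a , w , ≡.refl
  head-just (just a ∷ z ∷ u)    A ne w = head-just (z ∷ u) A ∷-≢[] (just a ∷ w)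
  head-just (nothing ∷ z ∷ u)   A ne w = head-just (z ∷ u) A ∷-≢[] (nothing ∷ w)

  toWord-fromWord-reverse : ∀ u → Admissible u → u ≡.≢ [] → toWord (fromWord (reverse u)) ≡ reverse u
  toWord-fromWord-reverse u A ne with reverse u | head-just u A ne []
  ... | _ | a , w , ≡.refl = toWord∘fromWord a w

  toWord-≢[] : ∀ t (S : Sym nv) → reverse (toWord (t ∷ S)) ≡.≢ []
  toWord-≢[] t S e with () ← List.reverse-injective {x = toWord (t ∷ S)} {y = []} e

-- Generating series of words and the shuffle product

module Words {c ℓ} (R : CommutativeRing c ℓ) {nv : ℕ} (V : Evaluation R nv) where
  open CommutativeRing R
  open Evaluation V
  open Sequences R
  open import Relation.Binary.Reasoning.Setoid setoid

  op : Letter nv → Seq → Seq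
  op (just a) f = D ⟦ a ⟧ f
  op nothing  f = f

  -- The coefficients of the integral of f ω from 0 to t, where ω is a dt / (1 - a t) for e_a and dt
  -- / t for e₀. Thus `eval` is an iterated integral, and `inv 0` = 0 fixes the constant of
  -- integration.
  app : Letter nv → Seq → Seq
  app z f m = inv m * op z f m

  op-cong : ∀ z {f g} → f ≐ g → op z f ≐ op z g
  op-cong (just a) e = D-cong refl e
  op-cong nothing  e = e

  op-∑ : ∀ {a} {A : Set a} z (xs : List A) (f : A → Seq) →
         op z (λ m → ∑ xs (λ x → f x m)) ≐ (λ m → ∑ xs (λ x → op z (f x) m))
  op-∑ nothing  xs       f m = refl
  op-∑ (just a) []       f m = D-0 ⟦ a ⟧ m
  op-∑ (just a) (x ∷ xs) f m = trans (D-+ ⟦ a ⟧ _ _ m) (+-congˡ (op-∑ (just a) xs f m))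

  app-cong : ∀ z {f g} → f ≐ g → app z f ≐ app z g
  app-cong z e m = *-congˡ (op-cong z e m)

  app-0 : ∀ z f → app z f 0 ≈ 0#
  app-0 z f = trans (*-congʳ inv-0) (zeroˡ _)

  eval : List (Letter nv) → Seq
  eval = foldr app δ

  -- For positive index, multiplying by m undoes the division. At index 0 the derivation yields 0,
  -- so the right-hand side must have no constant term: for e_a this holds by the definition of `D`,
  -- for e₀ because admissibility provides an earlier letter.
  θ-app : ∀ z w → Admissible (z ∷ w) → θ (app z (eval w)) ≐ op z (eval w)
  θ-app (just a) w       A zero    = zeroˡ _
  θ-app nothing  (z ∷ w) A zero    = trans (zeroˡ _) (sym (app-0 z (eval w)))
  θ-app z        w       A (suc m) =
    trans (sym (*-assoc _ _ _)) (trans (*-congʳ (nat*inv m)) (*-identityˡ _))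

  op-⋆ˡ : ∀ z f g → op z f ⋆ g ≐ op z (f ⋆ g)
  op-⋆ˡ (just a) f g m = sym (D-⋆ˡ ⟦ a ⟧ f g m)
  op-⋆ˡ nothing  f g m = refl

  op-⋆ʳ : ∀ z f g → f ⋆ op z g ≐ op z (f ⋆ g)
  op-⋆ʳ (just a) f g m = sym (D-⋆ʳ ⟦ a ⟧ f g m)
  op-⋆ʳ nothing  f g m = refl

  -- The Euler derivation θ removes the last letter, so Leibniz's rule is the shuffle recursion.
  ∑-shuffle : ∀ w w′ → Admissible w → Admissible w′ →
              (λ m → ∑ (shRev w w′) (λ u → eval u m)) ≐ eval w ⋆ eval w′
  ∑-shuffle []      w′        A A′ m = trans (+-identityʳ _) (sym (⋆-identityˡ _ m))
  ∑-shuffle (z ∷ w) []        A A′ m = trans (+-identityʳ _) (sym (⋆-identityʳ _ m))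
  ∑-shuffle (z ∷ w) (z′ ∷ w′) A A′ m = begin
    ∑ (map (z′ ∷_) us ++ map (z ∷_) us′) (λ u → eval u m)
      ≈⟨ ∑-++ (map (z′ ∷_) us) _ _ ⟩
    ∑ (map (z′ ∷_) us) (λ u → eval u m) + ∑ (map (z ∷_) us′) (λ u → eval u m)
      ≈⟨ +-cong (∑-map (z′ ∷_) us _) (∑-map (z ∷_) us′ _) ⟩
    ∑ us (λ u → inv m * op z′ (eval u) m) + ∑ us′ (λ u → inv m * op z (eval u) m)
      ≈⟨ +-cong (peel z′ us _ (∑-shuffle (z ∷ w) w′ A (admissible-tail z′ w′ A′)))
                (peel z us′ _ (∑-shuffle w (z′ ∷ w′) (admissible-tail z w A) A′)) ⟩
    inv m * op z′ (f ⋆ eval w′) m + inv m * op z (eval w ⋆ g) m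
      ≈⟨ distribˡ _ _ _ ⟨
    inv m * (op z′ (f ⋆ eval w′) m + op z (eval w ⋆ g) m)
      ≈⟨ *-congˡ (trans (+-comm _ _) (+-cong (leftTerm m) (rightTerm m))) ⟩
    inv m * ((θ f ⋆ g) m + (f ⋆ θ g) m)
      ≈⟨ *-congˡ (θ-⋆ f g m) ⟨
    inv m * (nat m * (f ⋆ g) m)
      ≈⟨ cancel m ⟩
    (f ⋆ g) m ∎
    where
    f g : Seq
    f = eval (z ∷ w)
    g = eval (z′ ∷ w′)
    us us′ : List (List (Letter nv))
    us  = shRev (z ∷ w) w′
    us′ = shRev w (z′ ∷ w′)
    peel : ∀ y vs h → (λ i → ∑ vs (λ u → eval u i)) ≐ h →
           ∑ vs (λ u → inv m * op y (eval u) m) ≈ inv m * op y h m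
    peel y vs h e = trans (sym (*-∑ vs (inv m) _))
      (*-congˡ (trans (sym (op-∑ y vs eval m)) (op-cong y e m)))
    leftTerm : (λ i → op z (eval w ⋆ g) i) ≐ θ f ⋆ g
    leftTerm i = trans (sym (op-⋆ˡ z (eval w) g i)) (⋆-cong {g = g} (λ j → sym (θ-app z w A j)) (λ _ → refl) i)
    rightTerm : (λ i → op z′ (f ⋆ eval w′) i) ≐ f ⋆ θ g
    rightTerm i = trans (sym (op-⋆ʳ z′ f (eval w′) i)) (⋆-cong {f = f} (λ _ → refl) (λ j → sym (θ-app z′ w′ A′ j)) i)
    -- Multiplying by m and then by `inv m` destroys the constant term; nothing is lost, because the
    -- series of a nonempty word has none.
    cancel : ∀ i → inv i * (nat i * (f ⋆ g) i) ≈ (f ⋆ g) i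
    cancel zero    = trans (*-congʳ inv-0) (trans (zeroˡ _)
      (sym (trans (*-congʳ (app-0 z (eval w))) (zeroˡ _))))
    cancel (suc i) = trans (sym (*-assoc _ _ _))
      (trans (*-congʳ (trans (*-comm _ _) (nat*inv i))) (*-identityˡ _))

-- Nested sums, their series, and the reflection of indices

Positive : ∀ {nv} → Sym nv → Set
Positive = All (λ t → 1 ≤ proj₂ t)

parse-positive : ∀ {nv} (step : Letter nv → ℕ × Sym nv → ℕ × Sym nv) →
  (∀ z S → step nothing (z , S) ≡ (suc z , S)) →
  (∀ a z S → step (just a) (z , S) ≡ (0 , (a , suc z) ∷ S)) →
  ∀ w → Positive (proj₂ (foldr step (0 , []) w))
parse-positive step e e′ []            = []
parse-positive step e e′ (nothing ∷ w)
  rewrite e (proj₁ (foldr step (0 , []) w)) (proj₂ (foldr step (0 , []) w)) =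
    parse-positive step e e′ w
parse-positive step e e′ (just a ∷ w)
  rewrite e′ a (proj₁ (foldr step (0 , []) w)) (proj₂ (foldr step (0 , []) w)) =
    s≤s z≤n ∷ parse-positive step e e′ w

fromWord-positive : ∀ {nv} (w : List (Letter nv)) → Positive (fromWord w)
fromWord-positive w = parse-positive _ (λ _ _ → ≡.refl) (λ _ _ _ → ≡.refl) w

suc+<-∸ : ∀ {m j M} → j < M ∸ suc m → suc (m ℕ.+ j) < M
suc+<-∸ {zero}  {M = suc M} j< = s<s j<
suc+<-∸ {suc m} {M = suc M} j< = s<s (suc+<-∸ {m} j<)

∸-<-suc : ∀ {m p} → m < p → p ∸ m ≡ suc (p ∸ suc m)
∸-<-suc {m} {p} m<p = ℕ.+-∸-assoc 1 m<p

twist : ∀ {nv} → Mono nv → Sym nv → Sym nv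
twist c = map (λ t → monoMul (proj₁ t) c , proj₂ t)

-- Under m ↦ p - m the gap before an index becomes the gap after it, so each exponent moves to the next base.
shift : ∀ {nv} → ℕ → Sym nv → Sym nv
shift l []             = (mono1 , l) ∷ []
shift l ((a , l′) ∷ Y) = (a , l) ∷ shift l′ Y

module NestedSums {c ℓ} (R : CommutativeRing c ℓ) {nv : ℕ} (V : Evaluation R nv) where
  open CommutativeRing R
  open Evaluation V
  open Sequences R
  open Words R V
  open import Algebra.Properties.CommutativeSemiring.Exp commutativeSemiring using (^-distrib-*)
  open import Relation.Binary.Reasoning.Setoid setoid

  -- `w k b` stands where b^(-k) stands in the original sum. Keeping it variable lets one recursion
  -- serve the exact powers, the reflected powers and the truncated expansion of the latter.
  Weight : Set c
  Weight = ℕ → ℕ → Carrier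

  step : Weight → ℕ → Mono nv × ℕ → Seq → Seq
  step w M (a , k) F m =
    ∑< (M ∸ suc m) (λ j → ⟦ a ⟧ ^ suc j * (w k (suc (m ℕ.+ j)) * F (suc (m ℕ.+ j))))

  powers : Weight
  powers k b = inv b ^ k

  nested : ℕ → Sym nv → Carrier
  nested M S = foldr (step powers M) (λ _ → 1#) S 0

  -- While `step` puts a new index below those already summed, this puts one above. The coefficient
  -- at `m` collects the chains whose top index is `m`.
  stepS : Seq → Mono nv × ℕ → Seq
  stepS v (a , k) m = inv m ^ k * D ⟦ a ⟧ v m

  step-cong : ∀ w M t {F F′} → (∀ b → b < M → F b ≈ F′ b) → step w M t F ≐ step w M t F′
  step-cong w M (a , k) e m = ∑<-cong (M ∸ suc m) λ j j< → *-congˡ (*-congˡ (e _ (suc+<-∸ {m} j<)))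

  foldl-step-cong : ∀ w M S {F F′} → (∀ b → b < M → F b ≈ F′ b) →
    ∀ b → b < M → foldl (flip (step w M)) F S b ≈ foldl (flip (step w M)) F′ S b
  foldl-step-cong w M []      e = e
  foldl-step-cong w M (t ∷ S) e = foldl-step-cong w M S λ b _ → step-cong w M t e b

  foldr-step-cong : ∀ w M S {F F′} → (∀ b → b < M → F b ≈ F′ b) →
    ∀ b → b < M → foldr (step w M) F S b ≈ foldr (step w M) F′ S b
  foldr-step-cong w M []      e = e
  foldr-step-cong w M (t ∷ S) e b _ = step-cong w M t (foldr-step-cong w M S e) b

  -- Each use of `∑<-D` transfers one entry from the sum over the indices above m to the series over
  -- the indices below it. Keeping `v` and `F` general allows the chain to be cut at any place, in
  -- particular between the x-part and the y-part.
  ∑<-foldr-step : ∀ M S v F → ∑< M (λ m → v m * foldr (step powers M) F S m)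
                              ≈ ∑< M (λ m → foldl stepS v S m * F m)
  ∑<-foldr-step M []            v F = refl
  ∑<-foldr-step M ((a , k) ∷ S) v F = begin
    ∑< M (λ m → v m * step powers M (a , k) G m)     ≈⟨ ∑<-D ⟦ a ⟧ v (λ b → powers k b * G b) M ⟩
    ∑< M (λ m → D ⟦ a ⟧ v m * (powers k m * G m))
      ≈⟨ ∑<-cong M (λ m _ → trans (sym (*-assoc _ _ _)) (*-congʳ (*-comm _ _))) ⟩
    ∑< M (λ m → stepS v (a , k) m * G m)             ≈⟨ ∑<-foldr-step M S (stepS v (a , k)) F ⟩
    ∑< M (λ m → foldl stepS (stepS v (a , k)) S m * F m) ∎
    where G = foldr (step powers M) F S

  ∑<-δ : ∀ M (f : Seq) → ∑< (suc M) (λ m → δ m * f m) ≈ f 0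
  ∑<-δ M f = trans (+-cong (*-identityˡ _) (trans (∑<-cong M λ j _ → zeroˡ (f (suc j))) (∑<-zero M))) (+-identityʳ _)

  nested-as-∑< : ∀ M S → nested (suc M) S ≈ ∑< (suc M) (foldl stepS δ S)
  nested-as-∑< M S = begin
    nested (suc M) S                                 ≈⟨ ∑<-δ M (foldr (step powers (suc M)) (λ _ → 1#) S) ⟨
    ∑< (suc M) (λ m → δ m * foldr (step powers (suc M)) (λ _ → 1#) S m)
                                                     ≈⟨ ∑<-foldr-step (suc M) S δ _ ⟩
    ∑< (suc M) (λ m → foldl stepS δ S m * 1#)        ≈⟨ ∑<-cong (suc M) (λ m _ → *-identityʳ (foldl stepS δ S m)) ⟩
    ∑< (suc M) (foldl stepS δ S)                     ∎

  foldl-app-cong : ∀ w {f g} → f ≐ g → foldl (flip app) f w ≐ foldl (flip app) g w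
  foldl-app-cong []      e = e
  foldl-app-cong (z ∷ w) e = foldl-app-cong w (app-cong z e)

  foldl-app-nothings : ∀ n v → foldl (flip app) v (replicate n nothing) ≐ (λ m → inv m ^ n * v m)
  foldl-app-nothings zero    v m = sym (*-identityˡ _)
  foldl-app-nothings (suc n) v m = trans (foldl-app-nothings n (app nothing v) m)
    (trans (sym (*-assoc _ _ _)) (*-congʳ (*-comm _ _)))

  -- In e_a e₀^(k-1) the letter e_a supplies one of the k divisions by the index and each e₀ one
  -- more; the count is right only for k at least 1.
  foldl-app-toWord : ∀ S → Positive S → ∀ v → foldl (flip app) v (toWord S) ≐ foldl stepS v S
  foldl-app-toWord []                []       v m = refl
  foldl-app-toWord ((a , suc k) ∷ S) (_ ∷ ps) v m = begin
    foldl (flip app) (app (just a) v) (replicate k nothing ++ toWord S) m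
      ≡⟨ ≡.cong (λ h → h m) (List.foldl-++ (flip app) (app (just a) v) (replicate k nothing) (toWord S)) ⟩
    foldl (flip app) (foldl (flip app) (app (just a) v) (replicate k nothing)) (toWord S) m
      ≈⟨ foldl-app-cong (toWord S) (λ i → trans (foldl-app-nothings k (app (just a) v) i)
           (trans (sym (*-assoc _ _ _)) (*-congʳ (*-comm _ _)))) m ⟩
    foldl (flip app) (stepS v (a , suc k)) (toWord S) m
      ≈⟨ foldl-app-toWord S ps _ m ⟩
    foldl stepS (stepS v (a , suc k)) S m ∎

  eval-reverse-toWord : ∀ S → Positive S → eval (reverse (toWord S)) ≐ foldl stepS δ S
  eval-reverse-toWord S ps m = trans
    (reflexive (≡.cong (λ h → h m) (List.reverse-foldr app δ (toWord S))))
    (foldl-app-toWord S ps δ m)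

  nested-fromWord : ∀ M u → Admissible u → u ≡.≢ [] →
                    nested (suc M) (fromWord (reverse u)) ≈ ∑< (suc M) (eval u)
  nested-fromWord M u A ne = begin
    nested (suc M) S                           ≈⟨ nested-as-∑< M S ⟩
    ∑< (suc M) (foldl stepS δ S)
      ≈⟨ ∑<-cong (suc M) (λ m _ → eval-reverse-toWord S (fromWord-positive (reverse u)) m) ⟨
    ∑< (suc M) (eval (reverse (toWord S)))
      ≡⟨ ≡.cong (λ x → ∑< (suc M) (eval x))
           (≡.trans (≡.cong reverse (toWord-fromWord-reverse u A ne)) (List.reverse-involutive u)) ⟩
    ∑< (suc M) (eval u) ∎
    where S = fromWord (reverse u)

  ∑-shuffleS : ∀ M t X t′ Y → Positive (t ∷ X) → Positive (t′ ∷ Y) →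
    ∑ (shuffleS (t ∷ X) (t′ ∷ Y)) (nested (suc M))
      ≈ ∑< (suc M) (foldl stepS δ (t ∷ X) ⋆ foldl stepS δ (t′ ∷ Y))
  ∑-shuffleS M t X t′ Y ps ps′ = begin
    ∑ (map fromWord (map reverse us)) (nested (suc M))
      ≈⟨ trans (∑-map fromWord (map reverse us) _) (∑-map reverse us _) ⟩
    ∑ us (λ u → nested (suc M) (fromWord (reverse u)))
      ≈⟨ terms us (shuffles-admissible u u′ A (toWord-≢[] t X) A′ (toWord-≢[] t′ Y)) ⟩
    ∑ us (λ u → ∑< (suc M) (eval u))
      ≈⟨ ∑<-∑ (suc M) us (λ m u → eval u m) ⟨
    ∑< (suc M) (λ m → ∑ us (λ u → eval u m))
      ≈⟨ ∑<-cong (suc M) (λ m _ → trans (∑-shuffle u u′ A A′ m)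
           (⋆-cong (eval-reverse-toWord (t ∷ X) ps) (eval-reverse-toWord (t′ ∷ Y) ps′) m)) ⟩
    ∑< (suc M) (foldl stepS δ (t ∷ X) ⋆ foldl stepS δ (t′ ∷ Y)) ∎
    where
    u u′ : List (Letter nv)
    u  = reverse (toWord (t ∷ X))
    u′ = reverse (toWord (t′ ∷ Y))
    us : List (List (Letter nv))
    us = shRev u u′
    A : Admissible u
    A = symbol-reverse-admissible (t ∷ X)
    A′ : Admissible u′
    A′ = symbol-reverse-admissible (t′ ∷ Y)
    terms : ∀ us → All AdmissibleNonEmpty us →
      ∑ us (λ u → nested (suc M) (fromWord (reverse u))) ≈ ∑ us (λ u → ∑< (suc M) (eval u))
    terms []       []              = refl
    terms (u ∷ us) ((A , ne) ∷ As) = +-cong (nested-fromWord M u A ne) (terms us As)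

  -- The powers of c telescope: starting from c^m, each gap multiplies by c to the length of the
  -- gap, so that c raised to the last index is what reaches `F`.
  foldr-step-twist : ∀ c w M S F →
    (λ m → ⟦ c ⟧ ^ m * foldr (step w M) F (twist c S) m) ≐ foldr (step w M) (λ i → ⟦ c ⟧ ^ i * F i) S
  foldr-step-twist c w M []            F m = refl
  foldr-step-twist c w M ((a , k) ∷ S) F m = trans (*-∑< (M ∸ suc m) (⟦ c ⟧ ^ m) _)
    (∑<-cong (M ∸ suc m) λ j _ → begin
      ⟦ c ⟧ ^ m * (⟦ monoMul a c ⟧ ^ suc j * (w k (b j) * G (b j)))
        ≈⟨ *-congˡ (*-congʳ (trans (^-congˡ (suc j) (⟦monoMul⟧ a c)) (^-distrib-* ⟦ a ⟧ ⟦ c ⟧ (suc j)))) ⟩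
      ⟦ c ⟧ ^ m * ((⟦ a ⟧ ^ suc j * ⟦ c ⟧ ^ suc j) * (w k (b j) * G (b j)))
        ≈⟨ solve 5 (λ x y z u g → x :* ((y :* z) :* (u :* g)) := y :* (u :* ((x :* z) :* g))) refl
             (⟦ c ⟧ ^ m) (⟦ a ⟧ ^ suc j) (⟦ c ⟧ ^ suc j) (w k (b j)) (G (b j)) ⟩
      ⟦ a ⟧ ^ suc j * (w k (b j) * ((⟦ c ⟧ ^ m * ⟦ c ⟧ ^ suc j) * G (b j)))
        ≈⟨ *-congˡ (*-congˡ (*-congʳ (trans (sym (^-homo-* ⟦ c ⟧ m (suc j)))
             (reflexive (≡.cong (⟦ c ⟧ ^_) (ℕ.+-suc m j)))))) ⟩
      ⟦ a ⟧ ^ suc j * (w k (b j) * (⟦ c ⟧ ^ b j * G (b j)))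
        ≈⟨ *-congˡ (*-congˡ (foldr-step-twist c w M S F (b j))) ⟩
      ⟦ a ⟧ ^ suc j * (w k (b j) * foldr (step w M) (λ i → ⟦ c ⟧ ^ i * F i) S (b j)) ∎)
    where
    b : ℕ → ℕ
    b j = suc (m ℕ.+ j)
    G = foldr (step w M) F (twist c S)

  reflected : ℕ → Weight
  reflected p l b = inv (p ∸ b) ^ l

  -- The substitution b to p - b for one index: positions below p - m become positions above m. The
  -- position b = p, where the denominator would be 0, drops out because `stepS` vanishes at 0.
  D-stepS : ∀ p z a l v m → m < p →
    D ⟦ z ⟧ (stepS v (a , l)) (p ∸ m) ≈ step (reflected p) p (z , l) (λ i → D ⟦ a ⟧ v (p ∸ i)) m
  D-stepS p z a l v m m<p = begin
    D ⟦ z ⟧ (stepS v (a , l)) (p ∸ m)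
      ≡⟨ ≡.cong (D ⟦ z ⟧ (stepS v (a , l))) (∸-<-suc m<p) ⟩
    D ⟦ z ⟧ (stepS v (a , l)) (suc (p ∸ suc m))
      ≈⟨ D-as-∑< ⟦ z ⟧ (stepS v (a , l)) (zeroʳ _) (p ∸ suc m) ⟩
    ∑< (p ∸ suc m) (λ j → ⟦ z ⟧ ^ suc j * stepS v (a , l) (p ∸ suc m ∸ j))
      ≈⟨ ∑<-cong (p ∸ suc m) (λ j _ → reflexive
           (≡.cong (λ i → ⟦ z ⟧ ^ suc j * stepS v (a , l) i) (ℕ.∸-+-assoc p (suc m) j))) ⟩
    step (reflected p) p (z , l) (λ i → D ⟦ a ⟧ v (p ∸ i)) m ∎

  -- The gap above each y-index is reflected together with the exponent at that index, which pairs
  -- each exponent with the next base. Above the top index stands the gap of base 1 from `∑<-⋆`, the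
  -- last entry of `shift`.
  D1-foldl-stepS : ∀ p a l Y v m → m < p →
    D 1# (foldl stepS v ((a , l) ∷ Y)) (p ∸ m)
      ≈ foldl (flip (step (reflected p) p)) (λ i → D ⟦ a ⟧ v (p ∸ i)) (shift l Y) m
  D1-foldl-stepS p a l []             v m m<p =
    trans (D-cong {f = stepS v (a , l)} (sym ⟦mono1⟧) (λ _ → refl) (p ∸ m)) (D-stepS p mono1 a l v m m<p)
  D1-foldl-stepS p a l ((a′ , l′) ∷ Y) v m m<p = trans
    (D1-foldl-stepS p a′ l′ Y (stepS v (a , l)) m m<p)
    (foldl-step-cong (reflected p) p (shift l′ Y) (λ i → D-stepS p a′ a l v i) m m<p)

  D-δ : ∀ a q → D a δ (suc q) ≈ a ^ suc q
  D-δ a zero    = *-congˡ (+-identityˡ _)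
  D-δ a (suc q) = *-congˡ (trans (+-identityʳ _) (D-δ a q))

  shuffle-as-nested : ∀ M t X a l Y → Positive (t ∷ X) → Positive ((a , l) ∷ Y) →
    ∑ (shuffleS (t ∷ X) ((a , l) ∷ Y)) (nested (suc M))
      ≈ foldr (step powers (suc M))
          (foldl (flip (step (reflected (suc M)) (suc M))) (λ i → ⟦ a ⟧ ^ (suc M ∸ i)) (shift l Y))
          (t ∷ X) 0
  shuffle-as-nested M t X a l Y ps ps′ = begin
    ∑ (shuffleS (t ∷ X) ((a , l) ∷ Y)) (nested p)
      ≈⟨ ∑-shuffleS M t X (a , l) Y ps ps′ ⟩
    ∑< p (f ⋆ foldl stepS δ ((a , l) ∷ Y))
      ≈⟨ ∑<-⋆ f (foldl stepS δ ((a , l) ∷ Y)) p ⟩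
    ∑< p (λ i → f i * D 1# (foldl stepS δ ((a , l) ∷ Y)) (p ∸ i))
      ≈⟨ ∑<-cong p (λ i i<p → *-congˡ {f i} (trans (D1-foldl-stepS p a l Y δ i i<p)
           (foldl-step-cong (reflected p) p (shift l Y) tail i i<p))) ⟩
    ∑< p (λ i → f i * G i)
      ≈⟨ ∑<-foldr-step p (t ∷ X) δ G ⟨
    ∑< p (λ i → δ i * foldr (step powers p) G (t ∷ X) i)
      ≈⟨ ∑<-δ M (foldr (step powers p) G (t ∷ X)) ⟩
    foldr (step powers p) G (t ∷ X) 0 ∎
    where
    p = suc M
    f = foldl stepS δ (t ∷ X)
    G = foldl (flip (step (reflected p) p)) (λ i → ⟦ a ⟧ ^ (p ∸ i)) (shift l Y)
    -- The gap from 0 to the lowest y-index, reflected: it now reaches from the highest index b up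
    -- to p.
    tail : ∀ b → b < p → D ⟦ a ⟧ δ (p ∸ b) ≈ ⟦ a ⟧ ^ (p ∸ b)
    tail b b<p rewrite ∸-<-suc b<p = D-δ ⟦ a ⟧ (p ∸ suc b)

-- The coefficient of t^f in (1 - t)^(-l). Truncated subtraction gives the right value at l = 0 as
-- well: 1 for f = 0, and (f - 1) choose f, which is 0, for larger f.
[l+f∸1]Cf : ℕ → ℕ → ℕ
[l+f∸1]Cf l f = (l ℕ.+ f ∸ 1) C f

[l+f∸1]Cf-pascal : ∀ l f → [l+f∸1]Cf (suc l) (suc f) ≡ [l+f∸1]Cf l (suc f) ℕ.+ [l+f∸1]Cf (suc l) f
[l+f∸1]Cf-pascal l f rewrite ℕ.+-suc l f =
  ≡.trans (≡.sym (nCk+nC[k+1]≡[n+1]C[k+1] (l ℕ.+ f) f)) (ℕ.+-comm ((l ℕ.+ f) C f) _)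

-- Congruences modulo powers of π and the binomial series

module Congruence {c ℓ} (R : CommutativeRing c ℓ) (I : IntegralElements R)
                  (π : CommutativeRing.Carrier R) (Int-π : IntegralElements.Int I π) where
  open CommutativeRing R
  open IntegralElements I
  open Sequences R
  open import Algebra.Properties.Ring ring using (-‿distribʳ-*; -‿involutive; -1*x≈-x)
  open import Algebra.Properties.Semiring.Mult semiring using (×-homo-+)
  open import Algebra.Properties.CommutativeSemiring.Exp commutativeSemiring using (^-distrib-*)
  open import Relation.Binary.Reasoning.Setoid setoid

  Int-^ : ∀ {x} n → Int x → Int (x ^ n)
  Int-^ zero    i = Int-1
  Int-^ (suc n) i = Int-* i (Int-^ n i)

  infix 4 _≋[_]_
  -- Integrality is required of the right-hand side and of the error. The left-hand side is then
  -- integral too, since π is, and so congruences can be multiplied.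
  _≋[_]_ : Carrier → ℕ → Carrier → Set _
  x ≋[ n ] y = Int y × ∃[ e ] (Int e × x ≈ y + π ^ n * e)

  ≋-refl : ∀ {x} n → Int x → x ≋[ n ] x
  ≋-refl n i = i , 0# , Int-0 , sym (trans (+-congˡ (zeroʳ _)) (+-identityʳ _))

  ≋-resp : ∀ {x x′ y y′} n → x′ ≈ x → y ≈ y′ → x ≋[ n ] y → x′ ≋[ n ] y′
  ≋-resp n ex ey (i , e , ie , eq) = Int-resp ey i , e , ie , trans ex (trans eq (+-congʳ ey))

  ≋-+ : ∀ {x x′ y y′} n → x ≋[ n ] y → x′ ≋[ n ] y′ → x + x′ ≋[ n ] y + y′
  ≋-+ {y = y} {y′} n (i , e , ie , eq) (i′ , e′ , ie′ , eq′) =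
    Int-+ i i′ , e + e′ , Int-+ ie ie′ , trans (+-cong eq eq′)
      (solve 5 (λ y y′ q e e′ → (y :+ q :* e) :+ (y′ :+ q :* e′) := (y :+ y′) :+ q :* (e :+ e′)) refl
        y y′ (π ^ n) e e′)

  ≋-* : ∀ {x x′ y y′} n → x ≋[ n ] y → x′ ≋[ n ] y′ → x * x′ ≋[ n ] y * y′
  ≋-* {y = y} {y′} n (i , e , ie , eq) (i′ , e′ , ie′ , eq′) =
    Int-* i i′ , e * y′ + (y + π ^ n * e) * e′ ,
    Int-+ (Int-* ie i′) (Int-* (Int-+ i (Int-* (Int-^ n Int-π) ie)) ie′) ,
    trans (*-cong eq eq′)
      (solve 5 (λ y y′ q e e′ → (y :+ q :* e) :* (y′ :+ q :* e′) :=
                 y :* y′ :+ q :* (e :* y′ :+ (y :+ q :* e) :* e′)) refl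
        y y′ (π ^ n) e e′)

  π*-≋ : ∀ {x y} n → x ≋[ n ] y → π * x ≋[ suc n ] π * y
  π*-≋ {y = y} n (i , e , ie , eq) = Int-* Int-π i , e , ie , trans (*-congˡ eq)
    (solve 4 (λ r y q e → r :* (y :+ q :* e) := r :* y :+ (r :* q) :* e) refl π y (π ^ n) e)

  ≋-∑< : ∀ n k {f g} → (∀ j → j < k → f j ≋[ n ] g j) → ∑< k f ≋[ n ] ∑< k g
  ≋-∑< n zero    e = ≋-refl n Int-0
  ≋-∑< n (suc k) e = ≋-+ n (e 0 z<s) (≋-∑< n k λ j j<k → e (suc j) (s<s j<k))

  geometric : Carrier → ℕ → Seq
  geometric x l f = nat ([l+f∸1]Cf l f) * (π ^ f * x ^ (l ℕ.+ f))

  -- The truncated form of v^(l+1) = x v^l + π x v^(l+1) for v = x / (1 - π x), by Pascal's rule.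
  -- The last sum has one term fewer because the factor π raises the order by one.
  ∑<-geometric-pascal : ∀ x l n → ∑< (suc n) (geometric x (suc l))
    ≈ x * ∑< (suc n) (geometric x l) + π * (x * ∑< n (geometric x (suc l)))
  ∑<-geometric-pascal x l n = begin
    nat 1 * (1# * (x * x ^ (l ℕ.+ 0))) + ∑< n (geometric x (suc l) ∘ suc)
      ≈⟨ +-congˡ (trans (∑<-cong n (λ f _ → term f)) (∑<-+ n _ _)) ⟩
    nat 1 * (1# * (x * x ^ (l ℕ.+ 0))) +
      (∑< n (λ f → x * geometric x l (suc f)) + ∑< n (λ f → (π * x) * geometric x (suc l) f))
      ≈⟨ +-congˡ (+-cong (*-∑< n x _) (*-∑< n (π * x) _)) ⟨
    nat 1 * (1# * (x * x ^ (l ℕ.+ 0))) +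
      (x * ∑< n (geometric x l ∘ suc) + (π * x) * ∑< n (geometric x (suc l)))
      ≈⟨ solve 6 (λ x q a b p k → k :* (con 1 :* (x :* q)) :+ (x :* a :+ (p :* x) :* b) :=
                   x :* (k :* (con 1 :* q) :+ a) :+ p :* (x :* b)) refl
           x (x ^ (l ℕ.+ 0)) (∑< n (geometric x l ∘ suc)) (∑< n (geometric x (suc l))) π (nat 1) ⟩
    x * ∑< (suc n) (geometric x l) + π * (x * ∑< n (geometric x (suc l))) ∎
    where
    term : ∀ f → geometric x (suc l) (suc f) ≈ x * geometric x l (suc f) + (π * x) * geometric x (suc l) f
    term f = begin
      nat ([l+f∸1]Cf (suc l) (suc f)) * (π ^ suc f * x ^ (suc l ℕ.+ suc f))
        ≈⟨ *-cong (trans (reflexive (≡.cong nat ([l+f∸1]Cf-pascal l f)))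
                    (×-homo-+ 1# ([l+f∸1]Cf l (suc f)) ([l+f∸1]Cf (suc l) f)))
                  (*-congˡ (*-congˡ (reflexive (≡.cong (x ^_) (ℕ.+-suc l f))))) ⟩
      (nat ([l+f∸1]Cf l (suc f)) + nat ([l+f∸1]Cf (suc l) f)) * (π ^ suc f * (x * x ^ (suc l ℕ.+ f)))
        ≈⟨ solve 6 (λ a b p q x y → (a :+ b) :* ((p :* q) :* (x :* y)) :=
                     x :* (a :* ((p :* q) :* y)) :+ (p :* x) :* (b :* (q :* y))) refl
             (nat ([l+f∸1]Cf l (suc f))) (nat ([l+f∸1]Cf (suc l) f)) π (π ^ f) x (x ^ (suc l ℕ.+ f)) ⟩
      x * (nat ([l+f∸1]Cf l (suc f)) * (π ^ suc f * x ^ (suc l ℕ.+ f)))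
        + (π * x) * geometric x (suc l) f
        ≈⟨ +-congʳ (*-congˡ (*-congˡ (*-congˡ (reflexive (≡.cong (x ^_) (≡.sym (ℕ.+-suc l f))))))) ⟩
      x * geometric x l (suc f) + (π * x) * geometric x (suc l) f ∎

  -- The equation says v = x / (1 - π x), and geometric x l is the binomial series of its l-th power.
  power-≋-geometric : ∀ {x v} → Int x → Int v → v ≈ x + π * (x * v) →
                      ∀ n l → v ^ l ≋[ n ] ∑< n (geometric x l)
  power-≋-geometric {x} {v} ix iv eq zero l =
    Int-0 , v ^ l , Int-^ l iv , sym (trans (+-identityˡ _) (*-identityˡ _))
  power-≋-geometric {x} {v} ix iv eq (suc n) zero = ≋-resp (suc n) refl (sym (begin
    nat 1 * (1# * 1#) + ∑< n (geometric x 0 ∘ suc)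
      ≈⟨ +-congˡ (∑<-cong n λ f _ → trans
           (*-congʳ (reflexive (≡.cong nat (k>n⇒nCk≡0 (ℕ.n<1+n f))))) (zeroˡ (π ^ suc f * x ^ suc f))) ⟩
    nat 1 * (1# * 1#) + ∑< n (λ _ → 0#)
      ≈⟨ +-cong (trans (*-cong (+-identityʳ 1#) (*-identityˡ 1#)) (*-identityˡ 1#)) (∑<-zero n) ⟩
    1# + 0#
      ≈⟨ +-identityʳ 1# ⟩
    1# ∎)) (≋-refl (suc n) Int-1)
  power-≋-geometric {x} {v} ix iv eq (suc n) (suc l) = ≋-resp (suc n)
    (trans (*-congʳ eq) (solve 4 (λ x r v y → (x :+ r :* (x :* v)) :* y := x :* y :+ r :* (x :* (v :* y))) refl
      x π v (v ^ l)))
    (sym (∑<-geometric-pascal x l n))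
    (≋-+ (suc n)
      (≋-* (suc n) (≋-refl (suc n) ix) (power-≋-geometric ix iv eq (suc n) l))
      -- Here the truncation at `n` suffices, since the factor π lifts a congruence modulo π^n to
      -- one modulo π^(n+1). This is what makes the double induction on `n` and `l` close.
      (π*-≋ n (≋-* n (≋-refl n ix) (power-≋-geometric ix iv eq n (suc l)))))

  coefficient : ℕ → ℕ → Carrier
  coefficient l f = (- 1#) ^ l * (nat ([l+f∸1]Cf l f) * π ^ f)

  -- Meant for y = b and z = π - b. Then x = 1/b, and -u = 1/(b - π) = x / (1 - π x) is the series
  -- expanded above; replacing -u by u costs the sign (-1)^l.
  inverse-power-≋ : ∀ {x u y z} → Int x → Int u → y * x ≈ 1# → z * u ≈ 1# → y + z ≈ π → ∀ n l →
    u ^ l ≋[ n ] ∑< n (λ f → coefficient l f * x ^ (l ℕ.+ f))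
  inverse-power-≋ {x} {u} {y} {z} ix iu yx zu yz n l = ≋-resp n
    (begin
      u ^ l                   ≈⟨ ^-congˡ l (trans (-1*x≈-x (- u)) (-‿involutive u)) ⟨
      (- 1# * - u) ^ l        ≈⟨ ^-distrib-* (- 1#) (- u) l ⟩
      (- 1#) ^ l * (- u) ^ l  ∎)
    (begin
      (- 1#) ^ l * ∑< n (geometric x l)
        ≈⟨ *-∑< n ((- 1#) ^ l) (geometric x l) ⟩
      ∑< n (λ f → (- 1#) ^ l * geometric x l f)
        ≈⟨ ∑<-cong n (λ f _ → solve 4 (λ s c q t → s :* (c :* (q :* t)) := (s :* (c :* q)) :* t) refl
             ((- 1#) ^ l) (nat ([l+f∸1]Cf l f)) (π ^ f) (x ^ (l ℕ.+ f))) ⟩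
      ∑< n (λ f → coefficient l f * x ^ (l ℕ.+ f)) ∎)
    (≋-* n (≋-refl n (Int-^ l (Int-neg Int-1))) (power-≋-geometric ix (Int-neg iu) recurrence n l))
    where
    x+u : x + u ≈ π * (x * u)
    x+u = begin
      x + u                         ≈⟨ +-cong (trans (*-congʳ zu) (*-identityˡ x)) (trans (*-congʳ yx) (*-identityˡ u)) ⟨
      (z * u) * x + (y * x) * u     ≈⟨ solve 4
                                         (λ x u y z → (z :* u) :* x :+ (y :* x) :* u := (y :+ z) :* (x :* u)) refl x u y z ⟩
      (y + z) * (x * u)             ≈⟨ *-congʳ yz ⟩
      π * (x * u)                   ∎
    recurrence : - u ≈ x + π * (x * - u)
    recurrence = begin
      - u                           ≈⟨ +-identityˡ _ ⟨
      0# + - u                      ≈⟨ +-congʳ (-‿inverseʳ (x + u)) ⟨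
      (x + u) + - (x + u) + - u     ≈⟨ solve 4
                                         (λ x u w v → ((x :+ u) :+ w) :+ v := x :+ (w :+ (u :+ v))) refl x u (- (x + u)) (- u) ⟩
      x + (- (x + u) + (u + - u))   ≈⟨ +-congˡ (trans (+-congˡ (-‿inverseʳ u)) (+-identityʳ _)) ⟩
      x + - (x + u)                 ≈⟨ +-congˡ (-‿cong x+u) ⟩
      x + - (π * (x * u))           ≈⟨ +-congˡ (trans (-‿distribʳ-* π (x * u)) (*-congˡ (-‿distribʳ-* x u))) ⟩
      x + π * (x * - u)             ∎

  coefficients : ∀ {s} → Vec ℕ s → Vec ℕ s → Carrier
  coefficients []       []       = 1#
  coefficients (l ∷ ls) (f ∷ fs) = coefficient l f * coefficients ls fs

  binomials : ∀ {s} → Vec ℕ s → Vec ℕ s → Carrier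
  binomials []       []       = 1#
  binomials (l ∷ ls) (f ∷ fs) = nat ([l+f∸1]Cf l f) * binomials ls fs

  total : ∀ {s} → Vec ℕ s → ℕ
  total = Vec.foldr _ ℕ._+_ 0

  coefficients-total : ∀ {s} (ls fs : Vec ℕ s) →
    coefficients ls fs ≈ (- 1#) ^ total ls * (binomials ls fs * π ^ total fs)
  coefficients-total []       []       = sym (trans (*-identityˡ _) (*-identityˡ 1#))
  coefficients-total (l ∷ ls) (f ∷ fs) = begin
    coefficient l f * coefficients ls fs
      ≈⟨ *-congˡ (coefficients-total ls fs) ⟩
    ((- 1#) ^ l * (nat ([l+f∸1]Cf l f) * π ^ f)) * ((- 1#) ^ total ls * (binomials ls fs * π ^ total fs))
      ≈⟨ solve 6 (λ s b q s′ b′ q′ → (s :* (b :* q)) :* (s′ :* (b′ :* q′)) :=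
                   (s :* s′) :* ((b :* b′) :* (q :* q′))) refl
           ((- 1#) ^ l) (nat ([l+f∸1]Cf l f)) (π ^ f) ((- 1#) ^ total ls) (binomials ls fs) (π ^ total fs) ⟩
    ((- 1#) ^ l * (- 1#) ^ total ls) * (binomials (l ∷ ls) (f ∷ fs) * (π ^ f * π ^ total fs))
      ≈⟨ *-cong (^-homo-* (- 1#) l (total ls)) (*-congˡ (^-homo-* π f (total fs))) ⟨
    (- 1#) ^ (l ℕ.+ total ls) * (binomials (l ∷ ls) (f ∷ fs) * π ^ (f ℕ.+ total fs)) ∎

-- The shuffle congruence for a fixed prime, in the abstract setting

zipSym : ∀ {nv s} → Vec (Mono nv) s → Vec ℕ s → Sym nv
zipSym zs ls = Vec.toList (Vec.zip zs ls)

module ShuffleCongruence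
  {c ℓ} (R : CommutativeRing c ℓ) {nv : ℕ} (V : Evaluation R nv) (I : IntegralElements R)
  (Int-⟦⟧ : ∀ a → IntegralElements.Int I (Evaluation.⟦_⟧ V a)) (M : ℕ)
  (Int-inv : ∀ b → suc b < suc M → IntegralElements.Int I (Evaluation.inv V (suc b)))
  (Int-p : IntegralElements.Int I (Sequences.nat R (suc M)))
  where
  open CommutativeRing R
  open Evaluation V
  open IntegralElements I
  open Sequences R
  open NestedSums R V
  open Congruence R I (nat (suc M)) Int-p
  open import Algebra.Properties.Semiring.Mult semiring using (×-homo-+)
  open import Algebra.Properties.CommutativeSemiring.Exp commutativeSemiring using (^-distrib-*)
  open import Relation.Binary.Reasoning.Setoid setoid

  p : ℕ
  p = suc M

  step-≋ : ∀ n w w′ t {F F′} → (∀ k b → b < M → w k (suc b) ≋[ n ] w′ k (suc b)) →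
           (∀ b → b < p → F b ≋[ n ] F′ b) → ∀ m → step w p t F m ≋[ n ] step w′ p t F′ m
  step-≋ n w w′ (a , k) ew eF m = ≋-∑< n (p ∸ suc m) λ j j< →
    ≋-* n (≋-refl n (Int-^ (suc j) (Int-⟦⟧ a)))
          (≋-* n (ew k (m ℕ.+ j) (ℕ.s<s⁻¹ (suc+<-∸ {m} j<))) (eF _ (suc+<-∸ {m} j<)))

  foldr-step-≋ : ∀ n w w′ S {F F′} → (∀ k b → b < M → w k (suc b) ≋[ n ] w′ k (suc b)) →
    (∀ b → b < p → F b ≋[ n ] F′ b) → ∀ b → b < p → foldr (step w p) F S b ≋[ n ] foldr (step w′ p) F′ S b
  foldr-step-≋ n w w′ []      ew eF = eF
  foldr-step-≋ n w w′ (t ∷ S) ew eF b _ = step-≋ n w w′ t ew (foldr-step-≋ n w w′ S ew eF) b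

  foldl-step-≋ : ∀ n w w′ S {F F′} → (∀ k b → b < M → w k (suc b) ≋[ n ] w′ k (suc b)) →
    (∀ b → b < p → F b ≋[ n ] F′ b) →
    ∀ b → b < p → foldl (flip (step w p)) F S b ≋[ n ] foldl (flip (step w′ p)) F′ S b
  foldl-step-≋ n w w′ []      ew eF = eF
  foldl-step-≋ n w w′ (t ∷ S) ew eF = foldl-step-≋ n w w′ S ew λ b _ → step-≋ n w w′ t ew eF b

  expanded : ℕ → Weight
  expanded n l b = ∑ (upTo n) (λ f → coefficient l f * powers (l ℕ.+ f) b)

  powers-≋ : ∀ n k b → b < M → powers k (suc b) ≋[ n ] powers k (suc b)
  powers-≋ n k b b<M = ≋-refl n (Int-^ k (Int-inv b (s<s b<M)))

  reflected-≋ : ∀ n k b → b < M → reflected p k (suc b) ≋[ n ] expanded n k (suc b)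
  reflected-≋ n k b b<M = ≋-resp n
    (reflexive (≡.cong (λ i → inv i ^ k) eq))
    (sym (∑-applyUpTo id n (λ f → coefficient k f * powers (k ℕ.+ f) (suc b))))
    -- The two denominators are b + 1 and p - (b + 1). Both lie strictly between 0 and p, so their
    -- inverses are integral, and they add up to p.
    (inverse-power-≋ (Int-inv b (s<s b<M)) (Int-inv (M ∸ suc b) p∸b<p) (nat*inv b) (nat*inv (M ∸ suc b))
      (trans (sym (×-homo-+ 1# (suc b) (suc (M ∸ suc b))))
             (reflexive (≡.cong nat (≡.cong suc (≡.trans (ℕ.+-suc b (M ∸ suc b)) (ℕ.m+[n∸m]≡n b<M))))))
      n k)
    where
    eq : M ∸ b ≡ suc (M ∸ suc b)
    eq = ∸-<-suc b<M
    p∸b<p : suc (M ∸ suc b) < p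
    p∸b<p = ≡.subst (_< p) eq (s≤s (ℕ.m∸n≤m M b))

  module _ {a} {A : Set a} (xs : List A) (d : A → Carrier) where

    step-∑ : ∀ w t (F : A → Seq) →
      step w p t (λ b → ∑ xs (λ x → d x * F x b)) ≐ (λ m → ∑ xs (λ x → d x * step w p t (F x) m))
    step-∑ w (z , k) F m = begin
      ∑< n (λ j → ⟦ z ⟧ ^ suc j * (w k (b j) * ∑ xs (λ x → d x * F x (b j))))
        ≈⟨ ∑<-cong n (λ j _ → trans (sym (*-assoc _ _ _)) (trans (*-∑ xs _ _) (∑-cong xs λ x →
             solve 4 (λ q u e y → (q :* u) :* (e :* y) := e :* (q :* (u :* y))) refl
               (⟦ z ⟧ ^ suc j) (w k (b j)) (d x) (F x (b j))))) ⟩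
      ∑< n (λ j → ∑ xs (λ x → d x * (⟦ z ⟧ ^ suc j * (w k (b j) * F x (b j)))))
        ≈⟨ ∑<-∑ n xs _ ⟩
      ∑ xs (λ x → ∑< n (λ j → d x * (⟦ z ⟧ ^ suc j * (w k (b j) * F x (b j)))))
        ≈⟨ ∑-cong xs (λ x → *-∑< n (d x) _) ⟨
      ∑ xs (λ x → d x * step w p (z , k) (F x) m) ∎
      where
      n : ℕ
      n = p ∸ suc m
      b : ℕ → ℕ
      b j = suc (m ℕ.+ j)

    foldr-step-∑ : ∀ w S (F : A → Seq) →
      ∀ m → m < p → foldr (step w p) (λ b → ∑ xs (λ x → d x * F x b)) S m
                  ≈ ∑ xs (λ x → d x * foldr (step w p) (F x) S m)
    foldr-step-∑ w []      F m m<p = refl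
    foldr-step-∑ w (t ∷ S) F m m<p =
      trans (step-cong w p t (foldr-step-∑ w S F) m) (step-∑ w t (λ x → foldr (step w p) (F x) S) m)

  foldr-step-* : ∀ w S d F m → m < p →
    foldr (step w p) (λ b → d * F b) S m ≈ d * foldr (step w p) F S m
  foldr-step-* w S d F m m<p = begin
    foldr (step w p) (λ b → d * F b) S m      ≈⟨ foldr-step-cong w p S (λ b _ → sym (+-identityʳ (d * F b))) m m<p ⟩
    foldr (step w p) (λ b → d * F b + 0#) S m ≈⟨ foldr-step-∑ (tt ∷ []) (λ _ → d) w S (λ _ → F) m m<p ⟩
    d * foldr (step w p) F S m + 0#           ≈⟨ +-identityʳ _ ⟩
    d * foldr (step w p) F S m                ∎

  foldl-step≡foldr-step : ∀ w S F → foldl (flip (step w p)) F S ≡ foldr (step w p) F (reverse S)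
  foldl-step≡foldr-step w S F = ≡.sym (List.reverse-foldr (step w p) F S)

  step-expanded : ∀ n z l F →
    step (expanded n) p (z , l) F ≐ (λ m → ∑ (upTo n) (λ f → coefficient l f * step powers p (z , l ℕ.+ f) F m))
  step-expanded n z l F m = begin
    ∑< k (λ j → ⟦ z ⟧ ^ suc j * (expanded n l (b j) * F (b j)))
      ≈⟨ ∑<-cong k (λ j _ → trans
           (solve 3 (λ q u y → q :* (u :* y) := (q :* y) :* u) refl (⟦ z ⟧ ^ suc j) (expanded n l (b j)) (F (b j)))
           (trans (*-∑ (upTo n) _ _) (∑-cong (upTo n) λ f →
             solve 4 (λ q u e y → (q :* y) :* (e :* u) := e :* (q :* (u :* y))) refl
               (⟦ z ⟧ ^ suc j) (powers (l ℕ.+ f) (b j)) (coefficient l f) (F (b j))))) ⟩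
    ∑< k (λ j → ∑ (upTo n) (λ f → coefficient l f * (⟦ z ⟧ ^ suc j * (powers (l ℕ.+ f) (b j) * F (b j)))))
      ≈⟨ ∑<-∑ k (upTo n) _ ⟩
    ∑ (upTo n) (λ f → ∑< k (λ j → coefficient l f * (⟦ z ⟧ ^ suc j * (powers (l ℕ.+ f) (b j) * F (b j)))))
      ≈⟨ ∑-cong (upTo n) (λ f → *-∑< k (coefficient l f) _) ⟨
    ∑ (upTo n) (λ f → coefficient l f * step powers p (z , l ℕ.+ f) F m) ∎
    where
    k : ℕ
    k = p ∸ suc m
    b : ℕ → ℕ
    b j = suc (m ℕ.+ j)

  module _ (r' s' : ℕ) where

    -- By multilinearity in the weights every index gets its own expansion exponent, and these
    -- together range over the box. The head entry is applied first and so sits innermost; reversing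
    -- the list makes it the initial function of a `foldr`, out of which its sum is drawn by
    -- linearity.
    foldl-expanded : ∀ n {s} (zs : Vec (Mono nv) s) ls F m → m < p →
      foldl (flip (step (expanded n) p)) F (zipSym zs ls) m
        ≈ ∑ (box r' s' s n) (λ fs → coefficients ls fs *
            foldl (flip (step powers p)) F (zipSym zs (Vec.zipWith ℕ._+_ ls fs)) m)
    foldl-expanded n []       []       F m m<p = sym (trans (+-identityʳ _) (*-identityˡ _))
    foldl-expanded n {suc s} (z ∷ zs) (l ∷ ls) F m m<p = begin
      foldl (flip (step (expanded n) p)) (step (expanded n) p (z , l) F) (zipSym zs ls) m
        ≈⟨ foldl-expanded n zs ls _ m m<p ⟩
      ∑ (box r' s' s n) (λ fs → coefficients ls fs *
        foldl (flip (step powers p)) (step (expanded n) p (z , l) F) (zipSym zs (Vec.zipWith ℕ._+_ ls fs)) m)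
        ≈⟨ ∑-cong (box r' s' s n) inner ⟩
      ∑ (box r' s' s n) (λ fs → ∑ (map (_∷ fs) (upTo n)) term)
        ≈⟨ ∑-concatMap (λ fs → map (_∷ fs) (upTo n)) (box r' s' s n) term ⟨
      ∑ (box r' s' (suc s) n) term ∎
      where
      term : Vec ℕ (suc s) → Carrier
      term fs = coefficients (l ∷ ls) fs *
        foldl (flip (step powers p)) F (zipSym (z ∷ zs) (Vec.zipWith ℕ._+_ (l ∷ ls) fs)) m
      inner : ∀ fs → coefficients ls fs * foldl (flip (step powers p)) (step (expanded n) p (z , l) F)
                       (zipSym zs (Vec.zipWith ℕ._+_ ls fs)) m ≈ ∑ (map (_∷ fs) (upTo n)) term
      inner fs = begin
        coefficients ls fs * foldl (flip (step powers p)) (step (expanded n) p (z , l) F) Z m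
          ≡⟨ ≡.cong (λ h → coefficients ls fs * h m) (foldl-step≡foldr-step powers Z (step (expanded n) p (z , l) F)) ⟩
        coefficients ls fs * foldr (step powers p) (step (expanded n) p (z , l) F) (reverse Z) m
          ≈⟨ *-congˡ (trans (foldr-step-cong powers p (reverse Z) (λ b _ → step-expanded n z l F b) m m<p)
               (foldr-step-∑ (upTo n) (coefficient l) powers (reverse Z) (λ f → step powers p (z , l ℕ.+ f) F) m m<p)) ⟩
        coefficients ls fs * ∑ (upTo n) (λ f → coefficient l f *
          foldr (step powers p) (step powers p (z , l ℕ.+ f) F) (reverse Z) m)
          ≈⟨ *-∑ (upTo n) (coefficients ls fs) _ ⟩
        ∑ (upTo n) (λ f → coefficients ls fs * (coefficient l f *
          foldr (step powers p) (step powers p (z , l ℕ.+ f) F) (reverse Z) m))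
          ≈⟨ ∑-cong (upTo n) (λ f → trans (sym (*-assoc _ _ _)) (*-cong (*-comm _ _)
               (reflexive (≡.cong (λ h → h m) (≡.sym (foldl-step≡foldr-step powers Z (step powers p (z , l ℕ.+ f) F))))))) ⟩
        ∑ (upTo n) (λ f → term (f ∷ fs))
          ≈⟨ ∑-map (_∷ fs) (upTo n) term ⟨
        ∑ (map (_∷ fs) (upTo n)) term ∎
        where Z = zipSym zs (Vec.zipWith ℕ._+_ ls fs)

    -- With c = 1/a the tail a^(p-i) is a^p c^i, and c^i is spread over the gaps by
    -- `foldr-step-twist`. The chain starts at index 0, so no stray power of c remains in front.
    foldr-geometric-tail : ∀ a c → ⟦ c ⟧ * ⟦ a ⟧ ≈ 1# → ∀ S →
      foldr (step powers p) (λ i → ⟦ a ⟧ ^ (p ∸ i)) S 0 ≈ ⟦ a ⟧ ^ p * nested p (twist c S)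
    foldr-geometric-tail a c ca S = begin
      foldr (step powers p) (λ i → ⟦ a ⟧ ^ (p ∸ i)) S 0
        ≈⟨ foldr-step-cong powers p S tail 0 z<s ⟩
      foldr (step powers p) (λ i → ⟦ a ⟧ ^ p * (⟦ c ⟧ ^ i * 1#)) S 0
        ≈⟨ foldr-step-* powers S (⟦ a ⟧ ^ p) (λ i → ⟦ c ⟧ ^ i * 1#) 0 z<s ⟩
      ⟦ a ⟧ ^ p * foldr (step powers p) (λ i → ⟦ c ⟧ ^ i * 1#) S 0
        ≈⟨ *-congˡ (trans (sym (*-identityˡ _)) (foldr-step-twist c powers p S (λ _ → 1#) 0)) ⟨
      ⟦ a ⟧ ^ p * (nested p (twist c S)) ∎
      where
      tail : ∀ i → i < p → ⟦ a ⟧ ^ (p ∸ i) ≈ ⟦ a ⟧ ^ p * (⟦ c ⟧ ^ i * 1#)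
      tail i i<p = begin
        ⟦ a ⟧ ^ (p ∸ i)
          ≈⟨ *-identityˡ _ ⟨
        1# * ⟦ a ⟧ ^ (p ∸ i)
          ≈⟨ *-congʳ (trans (sym (^-distrib-* ⟦ c ⟧ ⟦ a ⟧ i)) (trans (^-congˡ i ca) (1^ i))) ⟨
        (⟦ c ⟧ ^ i * ⟦ a ⟧ ^ i) * ⟦ a ⟧ ^ (p ∸ i)
          ≈⟨ solve 3 (λ x y z → (x :* y) :* z := (y :* z) :* (x :* con 1)) refl (⟦ c ⟧ ^ i) (⟦ a ⟧ ^ i) (⟦ a ⟧ ^ (p ∸ i)) ⟩
        (⟦ a ⟧ ^ i * ⟦ a ⟧ ^ (p ∸ i)) * (⟦ c ⟧ ^ i * 1#)
          ≈⟨ *-congʳ (trans (sym (^-homo-* ⟦ a ⟧ i (p ∸ i)))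
               (reflexive (≡.cong (⟦ a ⟧ ^_) (ℕ.m+[n∸m]≡n (ℕ.<⇒≤ i<p))))) ⟩
        ⟦ a ⟧ ^ p * (⟦ c ⟧ ^ i * 1#) ∎
        where
        1^ : ∀ n → 1# ^ n ≈ 1#
        1^ zero    = refl
        1^ (suc n) = trans (*-identityˡ _) (1^ n)

    shuffle-≋ : ∀ n t X a l Y c → ⟦ c ⟧ * ⟦ a ⟧ ≈ 1# → Positive (t ∷ X) → Positive ((a , l) ∷ Y) →
      ∀ {s} (zs : Vec (Mono nv) s) ls → shift l Y ≡ zipSym zs ls →
      ∑ (shuffleS (t ∷ X) ((a , l) ∷ Y)) (nested p)
        ≋[ n ] ∑ (box r' s' s n) (λ fs → coefficients ls fs *
                 (⟦ a ⟧ ^ p * nested p (twist c ((t ∷ X) ++ reverse (zipSym zs (Vec.zipWith ℕ._+_ ls fs))))))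
    shuffle-≋ n t X a l Y c ca ps ps′ {s} zs ls eq = ≋-resp n
      (shuffle-as-nested M t X a l Y ps ps′)
      (begin
        foldr (step powers p) (foldl (flip (step (expanded n) p)) T (shift l Y)) (t ∷ X) 0
          ≡⟨ ≡.cong (λ S → foldr (step powers p) (foldl (flip (step (expanded n) p)) T S) (t ∷ X) 0) eq ⟩
        foldr (step powers p) (foldl (flip (step (expanded n) p)) T (zipSym zs ls)) (t ∷ X) 0
          ≈⟨ foldr-step-cong powers p (t ∷ X) (foldl-expanded n zs ls T) 0 z<s ⟩
        foldr (step powers p) (λ m → ∑ (box r' s' s n) (λ fs →
            coefficients ls fs * foldl (flip (step powers p)) T (Z fs) m)) (t ∷ X) 0
          ≈⟨ foldr-step-∑ (box r' s' s n) (coefficients ls) powers (t ∷ X) _ 0 z<s ⟩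
        ∑ (box r' s' s n) (λ fs →
            coefficients ls fs * foldr (step powers p) (foldl (flip (step powers p)) T (Z fs)) (t ∷ X) 0)
          ≈⟨ ∑-cong (box r' s' s n) (λ fs → *-congˡ (trans
               (reflexive (≡.trans
                 (≡.cong (λ h → foldr (step powers p) h (t ∷ X) 0) (foldl-step≡foldr-step powers (Z fs) T))
                 (≡.cong (λ h → h 0) (≡.sym (List.foldr-++ (step powers p) T (t ∷ X) (reverse (Z fs)))))))
               (foldr-geometric-tail a c ca ((t ∷ X) ++ reverse (Z fs))))) ⟩
        ∑ (box r' s' s n) (λ fs → coefficients ls fs *
          (⟦ a ⟧ ^ p * nested p (twist c ((t ∷ X) ++ reverse (Z fs))))) ∎)
      -- The only approximation in the proof: the x-part keeps its weights, and in the y-part the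
      -- reflected weights are replaced by their truncated expansions.
      (foldr-step-≋ n powers powers (t ∷ X) (powers-≋ n)
        (foldl-step-≋ n (reflected p) (expanded n) (shift l Y) (reflected-≋ n)
          (λ b _ → ≋-refl n (Int-^ (p ∸ b) (Int-⟦⟧ a))))
        0 z<s)
      where
      T : Seq
      T i = ⟦ a ⟧ ^ (p ∸ i)
      Z : Vec ℕ s → Sym nv
      Z fs = zipSym zs (Vec.zipWith ℕ._+_ ls fs)

open ≡ using (refl; cong; cong₂; sym; trans; subst)

-- Rational numbers integral at a prime

invℚ : ℕ → ℚ
invℚ zero    = 0ℚ
invℚ (suc m) = + 1 ℚ./ suc m

toℚᵘ-/1 : ∀ i → toℚᵘ (i ℚ./ 1) ℚᵘ.≃ ℚᵘ.mkℚᵘ i 0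
toℚᵘ-/1 i = ℚ.toℚᵘ-fromℚᵘ (ℚᵘ.mkℚᵘ i 0)

fromℕℚ-suc : ∀ n → fromℕℚ (suc n) ≡ 1ℚ ℚ.+ fromℕℚ n
fromℕℚ-suc n = ℚ.toℚᵘ-injective (begin
  toℚᵘ (fromℕℚ (suc n))            ≈⟨ toℚᵘ-/1 (+ suc n) ⟩
  ℚᵘ.mkℚᵘ (+ suc n) 0              ≈⟨ ℚᵘ.*≡* (cong (ℤ._* (+ 1)) (cong (ℤ._+_ (+ 1)) (sym (ℤ.*-identityʳ (+ n))))) ⟩
  ℚᵘ.1ℚᵘ ℚᵘ.+ ℚᵘ.mkℚᵘ (+ n) 0      ≈⟨ ℚᵘ.+-congʳ ℚᵘ.1ℚᵘ (toℚᵘ-/1 (+ n)) ⟨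
  toℚᵘ 1ℚ ℚᵘ.+ toℚᵘ (fromℕℚ n)     ≈⟨ ℚ.toℚᵘ-homo-+ 1ℚ (fromℕℚ n) ⟨
  toℚᵘ (1ℚ ℚ.+ fromℕℚ n)           ∎)
  where open ℚᵘ.≃-Reasoning

fromℕℚ*invℚ : ∀ m → fromℕℚ (suc m) ℚ.* invℚ (suc m) ≡ 1ℚ
fromℕℚ*invℚ m = ℚ.toℚᵘ-injective (begin
  toℚᵘ (fromℕℚ (suc m) ℚ.* invℚ (suc m))           ≈⟨ ℚ.toℚᵘ-homo-* (fromℕℚ (suc m)) (invℚ (suc m)) ⟩
  toℚᵘ (fromℕℚ (suc m)) ℚᵘ.* toℚᵘ (invℚ (suc m))   ≈⟨ ℚᵘ.*-cong (toℚᵘ-/1 (+ suc m)) (ℚ.toℚᵘ-fromℚᵘ (ℚᵘ.mkℚᵘ (+ 1) m)) ⟩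
  ℚᵘ.mkℚᵘ (+ suc m) 0 ℚᵘ.* ℚᵘ.mkℚᵘ (+ 1) m         ≈⟨ ℚᵘ.*≡* (cong (+_ ∘ suc)
    (trans (ℕ.*-identityʳ _) (trans (ℕ.*-identityʳ m) (sym (trans (ℕ.+-identityʳ _) (ℕ.+-identityʳ m)))))) ⟩
  ℚᵘ.1ℚᵘ                                           ∎)
  where open ℚᵘ.≃-Reasoning

module Integral {p : ℕ} (pr : Prime p) where

  p-integral : ℚ → Set
  p-integral q = ¬ (p ∣ ↧ₙ q)

  ∤1 : ¬ (p ∣ 1)
  ∤1 d = ℕ.nonTrivial⇒≢1 {{prime⇒nonTrivial pr}} (ℕ.∣1⇒≡1 d)

  ∤-* : ∀ {m n} → ¬ (p ∣ m) → ¬ (p ∣ n) → ¬ (p ∣ m ℕ.* n)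
  ∤-* {m} {n} a b d = [ a , b ]′ (euclidsLemma m n pr d)

  ∤-factorˡ : ∀ {m n k} → m ℕ.* n ≡ k → ¬ (p ∣ k) → ¬ (p ∣ m)
  ∤-factorˡ {n = n} refl a d = a (ℕ.∣m⇒∣m*n n d)

  ∤-factorʳ : ∀ m {n k} → m ℕ.* n ≡ k → ¬ (p ∣ k) → ¬ (p ∣ n)
  ∤-factorʳ m refl a d = a (ℕ.∣n⇒∣m*n m d)

  ∣·∣-* : ∀ {i j k l} → i ℤ.* j ≡ k ℤ.* l → ∣ i ∣ ℕ.* ∣ j ∣ ≡ ∣ k ∣ ℕ.* ∣ l ∣
  ∣·∣-* {i} {j} {k} {l} e = trans (sym (ℤ.abs-* i j)) (trans (cong ∣_∣ e) (ℤ.abs-* k l))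

  ∣↥-*∣ : ∀ q r → ∃[ g ] ∣ ↥ (q ℚ.* r) ∣ ℕ.* g ≡ ∣ ↥ q ∣ ℕ.* ∣ ↥ r ∣ × ↧ₙ (q ℚ.* r) ℕ.* g ≡ ↧ₙ q ℕ.* ↧ₙ r
  ∣↥-*∣ q r = _ , ∣·∣-* {i = ↥ (q ℚ.* r)} {k = ↥ q} {l = ↥ r} (ℚ.↥-* q r)
                , ∣·∣-* {i = ↧ (q ℚ.* r)} {k = ↧ q} {l = ↧ r} (ℚ.↧-* q r)

  p-integral-+ : ∀ {q r} → p-integral q → p-integral r → p-integral (q ℚ.+ r)
  p-integral-+ {q} {r} a b = ∤-factorˡ (∣·∣-* {i = ↧ (q ℚ.+ r)} {k = ↧ q} {l = ↧ r} (ℚ.↧-+ q r)) (∤-* a b)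

  p-integral-* : ∀ {q r} → p-integral q → p-integral r → p-integral (q ℚ.* r)
  p-integral-* {q} {r} a b = ∤-factorˡ (proj₂ (proj₂ (∣↥-*∣ q r))) (∤-* a b)

  p-integral-neg : ∀ {q} → p-integral q → p-integral (ℚ.- q)
  p-integral-neg {q} a d = a (subst (p ∣_) (cong ∣_∣ (ℚ.↧-neg q)) d)

  p-integral-/ : ∀ i n → ¬ (p ∣ suc n) → p-integral (i ℚ./ suc n)
  p-integral-/ i n = ∤-factorˡ {n = ∣ gcd i (+ suc n) ∣}
    (trans (sym (ℤ.abs-* (↧ (i ℚ./ suc n)) (gcd i (+ suc n)))) (cong ∣_∣ (ℚ.↧-/ i (suc n))))

  p-integral-invℚ : ∀ b → suc b < p → p-integral (invℚ (suc b))
  p-integral-invℚ b b<p = p-integral-/ (+ 1) b λ d → ℕ.<⇒≱ b<p (ℕ.∣⇒≤ d)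

  -- Euclid's lemma removes one factor p at a time: once p^n is known to divide a, the remaining p
  -- must divide the cofactor of a, as it does not divide d.
  p^n∣-cancelʳ : ∀ n {a d} → ¬ (p ∣ d) → p ℕ.^ n ∣ a ℕ.* d → p ℕ.^ n ∣ a
  p^n∣-cancelʳ zero    {a}     _ _ = ℕ.1∣ a
  p^n∣-cancelʳ (suc n) {a} {d} c e with p^n∣-cancelʳ n {a} {d} c (ℕ.∣-trans (ℕ.n∣m*n p) e)
  ... | divides a′ refl with euclidsLemma a′ d pr (ℕ.*-cancelʳ-∣ (p ℕ.^ n) {{ℕ.m^n≢0 p n {{prime⇒nonZero pr}}}}
          (subst (p ℕ.* p ℕ.^ n ∣_) (swap a′ (p ℕ.^ n) d) e))
    where
    swap : ∀ x y z → x ℕ.* y ℕ.* z ≡ x ℕ.* z ℕ.* y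
    swap x y z = trans (ℕ.*-assoc x y z) (trans (cong (x ℕ.*_) (ℕ.*-comm y z)) (sym (ℕ.*-assoc x z y)))
  ... | inj₁ d′ = ℕ.*-monoˡ-∣ (p ℕ.^ n) d′
  ... | inj₂ d′ with () ← c d′

  ↥-fromℕℚ : ∀ m → ∣ ↥ (fromℕℚ m) ∣ ≡ m
  ↥-fromℕℚ m = begin
    ∣ ↥ (fromℕℚ m) ∣            ≡⟨ ℕ.*-identityʳ _ ⟨
    ∣ ↥ (fromℕℚ m) ∣ ℕ.* 1      ≡⟨ cong (∣ ↥ (fromℕℚ m) ∣ ℕ.*_) g≡1 ⟨
    ∣ ↥ (fromℕℚ m) ∣ ℕ.* g      ≡⟨ ℤ.abs-* (↥ (fromℕℚ m)) (gcd (+ m) (+ 1)) ⟨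
    ∣ ↥ (fromℕℚ m) ℤ.* gcd (+ m) (+ 1) ∣      ≡⟨ cong ∣_∣ (ℚ.↥-/ (+ m) 1) ⟩
    m                           ∎
    where
    open ≡.≡-Reasoning
    g : ℕ
    g = ∣ gcd (+ m) (+ 1) ∣
    g≡1 : g ≡ 1
    g≡1 = ℕ.∣1⇒≡1 (gcd[i,j]∣j (+ m) (+ 1))

  p-integral-fromℕℚ : ∀ n → p-integral (fromℕℚ n)
  p-integral-fromℕℚ n = p-integral-/ (+ n) 0 ∤1

  -- Reducing the product cancels a common factor g from numerator and denominator. As g divides the
  -- product of the two denominators it is prime to p, so no power of p is lost from the numerator.
  p^n∣-* : ∀ n {q r} → ∣ ↥ q ∣ ≡ p → p-integral q → p-integral r → p ℕ.^ n ∣ ∣ ↥ r ∣ →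
           p ℕ.^ suc n ∣ ∣ ↥ (q ℚ.* r) ∣
  p^n∣-* n {q} {r} q≡p iq ir d with ∣↥-*∣ q r
  ... | g , num , den = p^n∣-cancelʳ (suc n) {d = g} (∤-factorʳ (↧ₙ (q ℚ.* r)) den (∤-* iq ir))
    (subst (p ℕ.^ suc n ∣_) (trans (cong (ℕ._* ∣ ↥ r ∣) (sym q≡p)) (sym num)) (ℕ.*-monoʳ-∣ p d))

  qpow-InPPow : ∀ n {r} → p-integral r → InPPow p n (qpow (fromℕℚ p) n ℚ.* r)
  qpow-InPPow zero    {r} i rewrite ℚ.*-identityˡ r = ℕ.1∣ _ , i
  qpow-InPPow (suc n) {r} i =
    subst (InPPow p (suc n)) (sym (ℚ.*-assoc (fromℕℚ p) (qpow (fromℕℚ p) n) r))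
      (p^n∣-* n {P} {P^n*r} (↥-fromℕℚ p) (p-integral-fromℕℚ p) (proj₂ ih) (proj₁ ih)
      , p-integral-* {P} {P^n*r} (p-integral-fromℕℚ p) (proj₂ ih))
    where
    ih = qpow-InPPow n i
    P = fromℕℚ p
    P^n*r = qpow P n ℚ.* r

-- Formal sums of Laurent monomials as a commutative ring

module _ {nv : ℕ} where

  ⟨_,_⟩ : (Mono nv → ℚ) → Poly nv → ℚ
  ⟨ φ , P ⟩ = foldr (λ t s → proj₁ t ℚ.* φ (proj₂ t) ℚ.+ s) 0ℚ P

  -- Formal sums are compared through all functionals Mono nv → ℚ rather than through coefficients, because a product
  -- is then an iterated pairing; a record, so that P and Q can be inferred.
  infix 4 _≈ₚ_
  record _≈ₚ_ (P Q : Poly nv) : Set where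
    constructor mk≈
    field at : ∀ φ → ⟨ φ , P ⟩ ≡ ⟨ φ , Q ⟩
  open _≈ₚ_ public

  private
    open +-*-Solver

    rearrange-+ : ∀ a b x y → (a ℚ.+ b) ℚ.+ (x ℚ.+ y) ≡ (a ℚ.+ x) ℚ.+ (b ℚ.+ y)
    rearrange-+ = solve 4 (λ a b x y → (a :+ b) :+ (x :+ y) := (a :+ x) :+ (b :+ y)) refl

    rearrange-* : ∀ c d x y → (c ℚ.* d) ℚ.* x ℚ.+ c ℚ.* y ≡ c ℚ.* (d ℚ.* x ℚ.+ y)
    rearrange-* = solve 4 (λ c d x y → (c :* d) :* x :+ c :* y := c :* (d :* x :+ y)) refl

    rearrange-*′ : ∀ c d x y → d ℚ.* (c ℚ.* x) ℚ.+ c ℚ.* y ≡ c ℚ.* (d ℚ.* x ℚ.+ y)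
    rearrange-*′ = solve 4 (λ c d x y → d :* (c :* x) :+ c :* y := c :* (d :* x :+ y)) refl

    rearrange-neg : ∀ c x y → (ℚ.- c) ℚ.* x ℚ.+ (ℚ.- y) ≡ ℚ.- (c ℚ.* x ℚ.+ y)
    rearrange-neg = solve 3 (λ c x y → (:- c) :* x :+ (:- y) := :- (c :* x :+ y)) refl

  ⟨⟩-cong : ∀ {φ ψ} P → (∀ μ → φ μ ≡ ψ μ) → ⟨ φ , P ⟩ ≡ ⟨ ψ , P ⟩
  ⟨⟩-cong []            e = refl
  ⟨⟩-cong ((c , a) ∷ P) e = cong₂ (λ x y → c ℚ.* x ℚ.+ y) (e a) (⟨⟩-cong P e)

  ⟨⟩-++ : ∀ φ P Q → ⟨ φ , P ++ Q ⟩ ≡ ⟨ φ , P ⟩ ℚ.+ ⟨ φ , Q ⟩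
  ⟨⟩-++ φ []            Q = sym (ℚ.+-identityˡ _)
  ⟨⟩-++ φ ((c , a) ∷ P) Q =
    trans (cong (c ℚ.* φ a ℚ.+_) (⟨⟩-++ φ P Q)) (sym (ℚ.+-assoc (c ℚ.* φ a) ⟨ φ , P ⟩ ⟨ φ , Q ⟩))

  ⟨⟩-scale : ∀ φ c a P → ⟨ φ , scale c a P ⟩ ≡ c ℚ.* ⟨ (λ ν → φ (monoMul a ν)) , P ⟩
  ⟨⟩-scale φ c a []            = sym (ℚ.*-zeroʳ c)
  ⟨⟩-scale φ c a ((d , b) ∷ P) = trans (cong (c ℚ.* d ℚ.* φ (monoMul a b) ℚ.+_) (⟨⟩-scale φ c a P))
    (rearrange-* c d (φ (monoMul a b)) _)

  ⟨⟩-+ : ∀ φ ψ P → ⟨ (λ μ → φ μ ℚ.+ ψ μ) , P ⟩ ≡ ⟨ φ , P ⟩ ℚ.+ ⟨ ψ , P ⟩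
  ⟨⟩-+ φ ψ []            = refl
  ⟨⟩-+ φ ψ ((c , a) ∷ P) = trans (cong₂ ℚ._+_ (ℚ.*-distribˡ-+ c (φ a) (ψ a)) (⟨⟩-+ φ ψ P))
    (rearrange-+ (c ℚ.* φ a) (c ℚ.* ψ a) ⟨ φ , P ⟩ ⟨ ψ , P ⟩)

  ⟨⟩-* : ∀ c φ P → ⟨ (λ μ → c ℚ.* φ μ) , P ⟩ ≡ c ℚ.* ⟨ φ , P ⟩
  ⟨⟩-* c φ []            = sym (ℚ.*-zeroʳ c)
  ⟨⟩-* c φ ((d , a) ∷ P) = trans (cong (d ℚ.* (c ℚ.* φ a) ℚ.+_) (⟨⟩-* c φ P)) (rearrange-*′ c d (φ a) ⟨ φ , P ⟩)

  ⟨⟩-0 : ∀ P → ⟨ (λ _ → 0ℚ) , P ⟩ ≡ 0ℚ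
  ⟨⟩-0 []            = refl
  ⟨⟩-0 ((c , a) ∷ P) = trans (cong₂ ℚ._+_ (ℚ.*-zeroʳ c) (⟨⟩-0 P)) refl

  -- Interchange of two finite sums, from which the commutativity of the product is derived.
  ⟨⟩-swap : ∀ (ψ : Mono nv → Mono nv → ℚ) P Q →
            ⟨ (λ μ → ⟨ ψ μ , Q ⟩) , P ⟩ ≡ ⟨ (λ ν → ⟨ (λ μ → ψ μ ν) , P ⟩) , Q ⟩
  ⟨⟩-swap ψ []            Q = sym (⟨⟩-0 Q)
  ⟨⟩-swap ψ ((c , a) ∷ P) Q = trans (cong₂ ℚ._+_ (sym (⟨⟩-* c (ψ a) Q)) (⟨⟩-swap ψ P Q))
    (sym (⟨⟩-+ (λ ν → c ℚ.* ψ a ν) (λ ν → ⟨ (λ μ → ψ μ ν) , P ⟩) Q))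

  infixl 7 _*ₚ_
  _*ₚ_ : Poly nv → Poly nv → Poly nv
  P *ₚ Q = concatMap (λ t → scale (proj₁ t) (proj₂ t) Q) P

  negₚ : Poly nv → Poly nv
  negₚ = map (λ t → ℚ.- proj₁ t , proj₂ t)

  1ₚ : Poly nv
  1ₚ = [ (1ℚ , mono1) ]

  ⟨⟩-*ₚ : ∀ φ P Q → ⟨ φ , P *ₚ Q ⟩ ≡ ⟨ (λ μ → ⟨ (λ ν → φ (monoMul μ ν)) , Q ⟩) , P ⟩
  ⟨⟩-*ₚ φ []            Q = refl
  ⟨⟩-*ₚ φ ((c , a) ∷ P) Q = trans (⟨⟩-++ φ (scale c a Q) (P *ₚ Q)) (cong₂ ℚ._+_ (⟨⟩-scale φ c a Q) (⟨⟩-*ₚ φ P Q))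

  ⟨⟩-neg : ∀ φ P → ⟨ φ , negₚ P ⟩ ≡ ℚ.- ⟨ φ , P ⟩
  ⟨⟩-neg φ []            = refl
  ⟨⟩-neg φ ((c , a) ∷ P) = trans (cong ((ℚ.- c) ℚ.* φ a ℚ.+_) (⟨⟩-neg φ P)) (rearrange-neg c (φ a) ⟨ φ , P ⟩)

  ⟨⟩-monomial : ∀ φ c a → ⟨ φ , [ (c , a) ] ⟩ ≡ c ℚ.* φ a
  ⟨⟩-monomial φ c a = ℚ.+-identityʳ (c ℚ.* φ a)

  monoMul-assoc : ∀ (a b c : Mono nv) → monoMul (monoMul a b) c ≡ monoMul a (monoMul b c)
  monoMul-assoc = Vec.zipWith-assoc ℤ.+-assoc

  monoMul-comm : ∀ (a b : Mono nv) → monoMul a b ≡ monoMul b a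
  monoMul-comm = Vec.zipWith-comm ℤ.+-comm

  monoMul-identityˡ : ∀ (a : Mono nv) → monoMul mono1 a ≡ a
  monoMul-identityˡ = Vec.zipWith-identityˡ ℤ.+-identityˡ

  monoMul-inverseˡ : ∀ (a : Mono nv) → monoMul (monoInv a) a ≡ mono1
  monoMul-inverseˡ = Vec.zipWith-inverseˡ ℤ.+-inverseˡ

  *ₚ-comm : ∀ P Q → P *ₚ Q ≈ₚ Q *ₚ P
  *ₚ-comm P Q .at φ = trans (⟨⟩-*ₚ φ P Q) (trans (⟨⟩-swap _ P Q) (trans
    (⟨⟩-cong Q λ ν → ⟨⟩-cong P λ μ → cong φ (monoMul-comm μ ν)) (sym (⟨⟩-*ₚ φ Q P))))

  *ₚ-assoc : ∀ P Q S → (P *ₚ Q) *ₚ S ≈ₚ P *ₚ (Q *ₚ S)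
  *ₚ-assoc P Q S .at φ = trans (⟨⟩-*ₚ φ (P *ₚ Q) S) (trans (⟨⟩-*ₚ _ P Q) (trans
    (⟨⟩-cong P λ a → trans
      (⟨⟩-cong Q λ b → ⟨⟩-cong S λ c → cong φ (monoMul-assoc a b c))
      (sym (⟨⟩-*ₚ (λ ν → φ (monoMul a ν)) Q S)))
    (sym (⟨⟩-*ₚ φ P (Q *ₚ S)))))

  *ₚ-identityˡ : ∀ P → 1ₚ *ₚ P ≈ₚ P
  *ₚ-identityˡ P .at φ = trans (⟨⟩-*ₚ φ 1ₚ P) (trans
    (⟨⟩-monomial (λ μ → ⟨ (λ ν → φ (monoMul μ ν)) , P ⟩) 1ℚ mono1) (trans (ℚ.*-identityˡ _)
    (⟨⟩-cong P λ ν → cong φ (monoMul-identityˡ ν))))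

  *ₚ-cong : ∀ {P P′ Q Q′} → P ≈ₚ P′ → Q ≈ₚ Q′ → P *ₚ Q ≈ₚ P′ *ₚ Q′
  *ₚ-cong {P} {P′} {Q} {Q′} e e′ .at φ = trans (⟨⟩-*ₚ φ P Q) (trans
    (⟨⟩-cong P λ μ → e′ .at _) (trans (e .at _) (sym (⟨⟩-*ₚ φ P′ Q′))))

  *ₚ-distribʳ-++ : ∀ S P Q → (P ++ Q) *ₚ S ≈ₚ P *ₚ S ++ Q *ₚ S
  *ₚ-distribʳ-++ S P Q .at φ = trans (⟨⟩-*ₚ φ (P ++ Q) S) (trans (⟨⟩-++ _ P Q) (trans
    (cong₂ ℚ._+_ (sym (⟨⟩-*ₚ φ P S)) (sym (⟨⟩-*ₚ φ Q S)))
    (sym (⟨⟩-++ φ (P *ₚ S) (Q *ₚ S)))))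

  ++-congₚ : ∀ {P P′ Q Q′} → P ≈ₚ P′ → Q ≈ₚ Q′ → P ++ Q ≈ₚ P′ ++ Q′
  ++-congₚ {P} {P′} {Q} {Q′} e e′ .at φ =
    trans (⟨⟩-++ φ P Q) (trans (cong₂ ℚ._+_ (e .at φ) (e′ .at φ)) (sym (⟨⟩-++ φ P′ Q′)))

  ++-commₚ : ∀ P Q → P ++ Q ≈ₚ Q ++ P
  ++-commₚ P Q .at φ = trans (⟨⟩-++ φ P Q) (trans (ℚ.+-comm ⟨ φ , P ⟩ ⟨ φ , Q ⟩) (sym (⟨⟩-++ φ Q P)))

  ≈ₚ-refl : ∀ {P} → P ≈ₚ P
  ≈ₚ-refl .at φ = refl

  ≈ₚ-sym : ∀ {P Q} → P ≈ₚ Q → Q ≈ₚ P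
  ≈ₚ-sym e .at φ = sym (e .at φ)

  ≈ₚ-trans : ∀ {P Q S} → P ≈ₚ Q → Q ≈ₚ S → P ≈ₚ S
  ≈ₚ-trans e e′ .at φ = trans (e .at φ) (e′ .at φ)

  ≈ₚ-reflexive : ∀ {P Q} → P ≡ Q → P ≈ₚ Q
  ≈ₚ-reflexive refl = ≈ₚ-refl

  negₚ-inverseˡ : ∀ P → negₚ P ++ P ≈ₚ []
  negₚ-inverseˡ P .at φ = trans (⟨⟩-++ φ (negₚ P) P)
    (trans (cong (ℚ._+ ⟨ φ , P ⟩) (⟨⟩-neg φ P)) (ℚ.+-inverseˡ ⟨ φ , P ⟩))


polyRing : ℕ → CommutativeRing 0ℓ 0ℓ
polyRing nv = record
  { Carrier = Poly nv ; _≈_ = _≈ₚ_ ; _+_ = _++_ ; _*_ = _*ₚ_ ; -_ = negₚ ; 0# = [] ; 1# = 1ₚ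
  ; isCommutativeRing = record
    { isRing = record
      { +-isAbelianGroup = record
        { isGroup = record
          { isMonoid = record
            { isSemigroup = record
              { isMagma = record
                { isEquivalence = record { refl = ≈ₚ-refl ; sym = ≈ₚ-sym ; trans = ≈ₚ-trans }
                ; ∙-cong = ++-congₚ }
              ; assoc = λ P Q S → ≈ₚ-reflexive (List.++-assoc P Q S) }
            ; identity = (λ _ → ≈ₚ-refl) , (λ P → ≈ₚ-reflexive (List.++-identityʳ P)) }
          ; inverse = negₚ-inverseˡ , λ P → ≈ₚ-trans (++-commₚ P (negₚ P)) (negₚ-inverseˡ P)
          ; ⁻¹-cong = λ {P} {Q} e → mk≈ λ φ → trans (⟨⟩-neg φ P) (trans (cong ℚ.-_ (e .at φ)) (sym (⟨⟩-neg φ Q))) }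
        ; comm = ++-commₚ }
      ; *-cong = *ₚ-cong
      ; *-assoc = *ₚ-assoc
      ; *-identity = *ₚ-identityˡ , λ P → ≈ₚ-trans (*ₚ-comm P 1ₚ) (*ₚ-identityˡ P)
      ; distrib = 
          (λ S P Q → ≈ₚ-trans (*ₚ-comm S (P ++ Q))
            (≈ₚ-trans (*ₚ-distribʳ-++ S P Q) (++-congₚ (*ₚ-comm P S) (*ₚ-comm Q S))))
        , *ₚ-distribʳ-++ }
    ; *-comm = *ₚ-comm } }

-- Matching the reflected symbol with the symbol of the right-hand side

shift-tabulate : ∀ {nv s} (z : Fin s → Mono nv) (l : Fin (suc s) → ℕ) →
  shift (l Fin.zero) (List.tabulate (λ j → z j , l (Fin.suc j)))
    ≡ zipSym (Vec.tabulate z Vec.∷ʳ mono1) (Vec.tabulate l)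
shift-tabulate {s = zero}  z l = refl
shift-tabulate {s = suc s} z l = cong ((z Fin.zero , l Fin.zero) ∷_) (shift-tabulate (z ∘ Fin.suc) (l ∘ Fin.suc))

zip-∷ʳ : ∀ {A B : Set} {n} (xs : Vec A n) (ys : Vec B n) x y →
         Vec.zip (xs Vec.∷ʳ x) (ys Vec.∷ʳ y) ≡ Vec.zip xs ys Vec.∷ʳ (x , y)
zip-∷ʳ []       []       x y = refl
zip-∷ʳ (a ∷ xs) (b ∷ ys) x y = cong ((a , b) ∷_) (zip-∷ʳ xs ys x y)

zip-reverse : ∀ {A B : Set} {n} (xs : Vec A n) (ys : Vec B n) →
              Vec.zip (Vec.reverse xs) (Vec.reverse ys) ≡ Vec.reverse (Vec.zip xs ys)
zip-reverse []       []       = refl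
zip-reverse (x ∷ xs) (y ∷ ys) = begin
  Vec.zip (Vec.reverse (x ∷ xs)) (Vec.reverse (y ∷ ys))         ≡⟨ cong₂ Vec.zip (Vec.reverse-∷ x xs) (Vec.reverse-∷ y ys) ⟩
  Vec.zip (Vec.reverse xs Vec.∷ʳ x) (Vec.reverse ys Vec.∷ʳ y)   ≡⟨ zip-∷ʳ (Vec.reverse xs) (Vec.reverse ys) x y ⟩
  Vec.zip (Vec.reverse xs) (Vec.reverse ys) Vec.∷ʳ (x , y)      ≡⟨ cong (Vec._∷ʳ (x , y)) (zip-reverse xs ys) ⟩
  Vec.reverse (Vec.zip xs ys) Vec.∷ʳ (x , y)                    ≡⟨ Vec.reverse-∷ (x , y) (Vec.zip xs ys) ⟨
  Vec.reverse ((x , y) ∷ Vec.zip xs ys)                         ∎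
  where open ≡.≡-Reasoning

reverse-∷ʳ : ∀ {A : Set} {n} (xs : Vec A n) x → Vec.reverse (xs Vec.∷ʳ x) ≡ x ∷ Vec.reverse xs
reverse-∷ʳ xs x = Vec.reverse-reverse
  (trans (Vec.reverse-∷ x (Vec.reverse xs)) (cong (Vec._∷ʳ x) (Vec.reverse-involutive xs)))

zipSym-reverse : ∀ {nv s} (zs : Vec (Mono nv) s) ls →
                 reverse (zipSym zs ls) ≡ zipSym (Vec.reverse zs) (Vec.reverse ls)
zipSym-reverse zs ls = sym (trans (cong Vec.toList (zip-reverse zs ls)) (Vec.toList-reverse (Vec.zip zs ls)))

twist-zipSym : ∀ {nv s} c (zs : Vec (Mono nv) s) ls →
               twist c (zipSym zs ls) ≡ zipSym (Vec.map (λ z → monoMul z c) zs) ls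
twist-zipSym c []       []       = refl
twist-zipSym c (z ∷ zs) (l ∷ ls) = cong ((monoMul z c , l) ∷_) (twist-zipSym c zs ls)

zipWith-tabulate-lookup : ∀ {s} (l : Fin s → ℕ) (fs : Vec ℕ s) →
  Vec.zipWith ℕ._+_ (Vec.tabulate l) fs ≡ Vec.tabulate (λ j → l j ℕ.+ Vec.lookup fs j)
zipWith-tabulate-lookup l []       = refl
zipWith-tabulate-lookup l (f ∷ fs) = cong (l Fin.zero ℕ.+ f ∷_) (zipWith-tabulate-lookup (l ∘ Fin.suc) fs)

module _ (r' s' : ℕ) where

  -- The entries in the order in which `shift` leaves them, from the innermost sum outwards: y₂,
  -- ..., y_s and finally the base 1. Reversal puts the base 1 first, and the twist turns it into
  -- 1/y₁.
  zipSymY : (Fin (suc s') → ℕ) → Vec ℕ (suc s') → Sym (nv r' s')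
  zipSymY l fs = zipSym (Vec.tabulate (yv r' s' ∘ Fin.suc) Vec.∷ʳ mono1) (Vec.zipWith ℕ._+_ (Vec.tabulate l) fs)

  twist-reverse-zipSymY : ∀ l fs → twist (y₁⁻¹ r' s') (reverse (zipSymY l fs))
    ≡ zipSym (y₁⁻¹ r' s' ∷ Vec.reverse (Vec.tabulate (λ j → monoMul (yv r' s' (Fin.suc j)) (y₁⁻¹ r' s'))))
             (Vec.reverse (Vec.tabulate (λ j → l j ℕ.+ Vec.lookup fs j)))
  twist-reverse-zipSymY l fs = begin
    twist c (reverse (zipSym (ys Vec.∷ʳ mono1) ms))
      ≡⟨ cong (twist c) (zipSym-reverse (ys Vec.∷ʳ mono1) ms) ⟩
    twist c (zipSym (Vec.reverse (ys Vec.∷ʳ mono1)) (Vec.reverse ms))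
      ≡⟨ cong (λ zs → twist c (zipSym zs (Vec.reverse ms))) (reverse-∷ʳ ys mono1) ⟩
    twist c (zipSym (mono1 ∷ Vec.reverse ys) (Vec.reverse ms))
      ≡⟨ twist-zipSym c (mono1 ∷ Vec.reverse ys) (Vec.reverse ms) ⟩
    zipSym (monoMul mono1 c ∷ Vec.map (λ z → monoMul z c) (Vec.reverse ys)) (Vec.reverse ms)
      ≡⟨ cong₂ zipSym (cong₂ _∷_ (monoMul-identityˡ c)
           (trans (Vec.map-reverse (λ z → monoMul z c) ys)
             (cong Vec.reverse (sym (Vec.tabulate-∘ (λ z → monoMul z c) (yv r' s' ∘ Fin.suc))))))
           (cong Vec.reverse (zipWith-tabulate-lookup l fs)) ⟩
    zipSym (c ∷ Vec.reverse (Vec.tabulate (λ j → monoMul (yv r' s' (Fin.suc j)) c)))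
           (Vec.reverse (Vec.tabulate (λ j → l j ℕ.+ Vec.lookup fs j))) ∎
    where
    open ≡.≡-Reasoning
    c  = y₁⁻¹ r' s'
    ys = Vec.tabulate (yv r' s' ∘ Fin.suc)
    ms = Vec.zipWith ℕ._+_ (Vec.tabulate l) fs

  symRHS-as-twist : ∀ k l fs →
    symRHS r' s' k l (Vec.lookup fs) ≡ twist (y₁⁻¹ r' s') (symX r' s' k ++ reverse (zipSymY l fs))
  symRHS-as-twist k l fs = sym (trans (List.map-++ _ (symX r' s' k) (reverse (zipSymY l fs)))
    (cong₂ _++_ (List.map-tabulate (λ i → xv r' s' i , k i) _) (twist-reverse-zipSymY l fs)))

-- Coefficients, constants and integrality of polynomials

indicator : ∀ {nv} → Mono nv → Mono nv → ℚ
indicator μ ν with Vec.≡-dec ℤ._≟_ ν μ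
... | yes _ = 1ℚ
... | no  _ = 0ℚ

coeff-as-⟨⟩ : ∀ {nv} μ (P : Poly nv) → coeff μ P ≡ ⟨ indicator μ , P ⟩
coeff-as-⟨⟩ μ []            = refl
coeff-as-⟨⟩ μ ((c , ν) ∷ P) with Vec.≡-dec ℤ._≟_ ν μ
... | yes _ = cong₂ ℚ._+_ (sym (ℚ.*-identityʳ c)) (coeff-as-⟨⟩ μ P)
... | no  _ = trans (coeff-as-⟨⟩ μ P) (trans (sym (ℚ.+-identityˡ _)) (cong (ℚ._+ ⟨ indicator μ , P ⟩) (sym (ℚ.*-zeroʳ c))))

module PolyConstants (nv : ℕ) where
  open CommutativeRing (polyRing nv) using (_≈_; *-congˡ; *-congʳ)
    renaming (refl to ≈-refl; trans to ≈-trans; sym to ≈-sym)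
  open Sequences (polyRing nv)

  ι : ℚ → Poly nv
  ι q = [ (q , mono1) ]

  monomial : Mono nv → Poly nv
  monomial a = [ (1ℚ , a) ]

  ⟨⟩-ι* : ∀ φ q P → ⟨ φ , ι q *ₚ P ⟩ ≡ q ℚ.* ⟨ φ , P ⟩
  ⟨⟩-ι* φ q P = trans (⟨⟩-*ₚ φ (ι q) P) (trans (⟨⟩-monomial (λ μ → ⟨ (λ ν → φ (monoMul μ ν)) , P ⟩) q mono1)
    (cong (q ℚ.*_) (⟨⟩-cong P λ ν → cong φ (monoMul-identityˡ ν))))

  ⟨⟩-monomial* : ∀ φ a P → ⟨ φ , monomial a *ₚ P ⟩ ≡ ⟨ (λ ν → φ (monoMul a ν)) , P ⟩
  ⟨⟩-monomial* φ a P = trans (⟨⟩-*ₚ φ (monomial a) P)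
    (trans (⟨⟩-monomial (λ μ → ⟨ (λ ν → φ (monoMul μ ν)) , P ⟩) 1ℚ a) (ℚ.*-identityˡ _))

  scale-as-* : ∀ c a P → scale c a P ≈ ι c *ₚ (monomial a *ₚ P)
  scale-as-* c a P .at φ = trans (⟨⟩-scale φ c a P)
    (sym (trans (⟨⟩-ι* φ c (monomial a *ₚ P)) (cong (c ℚ.*_) (⟨⟩-monomial* φ a P))))

  monomial-* : ∀ a b → monomial (monoMul a b) ≈ monomial a *ₚ monomial b
  monomial-* a b .at φ = trans (⟨⟩-monomial φ 1ℚ (monoMul a b))
    (sym (trans (⟨⟩-monomial* φ a (monomial b)) (⟨⟩-monomial (λ ν → φ (monoMul a ν)) 1ℚ b)))

  ι-* : ∀ q r → ι (q ℚ.* r) ≈ ι q *ₚ ι r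
  ι-* q r .at φ = trans (⟨⟩-monomial φ (q ℚ.* r) mono1) (trans (ℚ.*-assoc q r (φ mono1))
    (sym (trans (⟨⟩-ι* φ q (ι r)) (cong (q ℚ.*_) (⟨⟩-monomial φ r mono1)))))

  ι-+ : ∀ q r → ι (q ℚ.+ r) ≈ ι q ++ ι r
  ι-+ q r .at φ = trans (⟨⟩-monomial φ (q ℚ.+ r) mono1) (trans (ℚ.*-distribʳ-+ (φ mono1) q r)
    (sym (trans (⟨⟩-++ φ (ι q) (ι r)) (cong₂ ℚ._+_ (⟨⟩-monomial φ q mono1) (⟨⟩-monomial φ r mono1)))))

  ι-0 : ι 0ℚ ≈ []
  ι-0 .at φ = trans (⟨⟩-monomial φ 0ℚ mono1) (ℚ.*-zeroˡ (φ mono1))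

  ι-neg : ∀ q → ι (ℚ.- q) ≈ negₚ 1ₚ *ₚ ι q
  ι-neg q .at φ = trans (⟨⟩-monomial φ (ℚ.- q) mono1)
    (sym (trans (⟨⟩-ι* φ (ℚ.- 1ℚ) (ι q)) (trans (cong ((ℚ.- 1ℚ) ℚ.*_) (⟨⟩-monomial φ q mono1))
      (trans (sym (ℚ.neg-distribˡ-* 1ℚ (q ℚ.* φ mono1)))
        (trans (cong ℚ.-_ (ℚ.*-identityˡ (q ℚ.* φ mono1))) (ℚ.neg-distribˡ-* q (φ mono1)))))))

  ι-sign : ∀ n → ι (signℚ n) ≈ negₚ 1ₚ ^ n
  ι-sign zero    = ≈-refl
  ι-sign (suc n) = ≈-trans (ι-neg (signℚ n)) (*-congˡ {x = negₚ 1ₚ} (ι-sign n))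

  ι-qpow : ∀ q n → ι (qpow q n) ≈ ι q ^ n
  ι-qpow q zero    = ≈-refl
  ι-qpow q (suc n) = ≈-trans (ι-* q (qpow q n)) (*-congˡ {x = ι q} (ι-qpow q n))

  ι-nat : ∀ n → ι (fromℕℚ n) ≈ nat n
  ι-nat zero    = ι-0
  ι-nat (suc n) = ≈-trans (≈ₚ-reflexive (cong ι (fromℕℚ-suc n)))
    (≈-trans (ι-+ 1ℚ (fromℕℚ n)) (++-congₚ {P = 1ₚ} ≈-refl (ι-nat n)))

  monomial-^ : ∀ a n → monomial (monoPow a n) ≈ monomial a ^ n
  monomial-^ a zero    = ≈ₚ-reflexive (cong monomial (monoPow-0 a))
    where
    monoPow-0 : ∀ {n} (a : Mono n) → monoPow a 0 ≡ mono1
    monoPow-0 []      = refl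
    monoPow-0 (e ∷ a) = cong (+ 0 ∷_) (monoPow-0 a)
  monomial-^ a (suc n) = ≈-trans (≈ₚ-reflexive (cong monomial (monoPow-suc a)))
    (≈-trans (monomial-* a (monoPow a n)) (*-congˡ {x = monomial a} (monomial-^ a n)))
    where
    monoPow-suc : ∀ {m} (a : Mono m) → monoPow a (suc n) ≡ monoMul a (monoPow a n)
    monoPow-suc []      = refl
    monoPow-suc (e ∷ a) = cong₂ _∷_ (ℤ.suc-* (+ n) e) (monoPow-suc a)

  inv : ℕ → Poly nv
  inv = ι ∘ invℚ

  nat*inv : ∀ m → nat (suc m) *ₚ inv (suc m) ≈ 1ₚ
  nat*inv m = ≈-trans (*-congʳ {x = inv (suc m)} (≈-sym (ι-nat (suc m))))
    (≈-trans (≈-sym (ι-* (fromℕℚ (suc m)) (invℚ (suc m)))) (≈ₚ-reflexive (cong ι (fromℕℚ*invℚ m))))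

  concatMap≡∑ : ∀ {A : Set} (f : A → Poly nv) xs → concatMap f xs ≡ ∑ xs f
  concatMap≡∑ f []       = refl
  concatMap≡∑ f (x ∷ xs) = cong (f x ++_) (concatMap≡∑ f xs)

  evaluation : Evaluation (polyRing nv) nv
  evaluation = record
    { ⟦_⟧ = monomial ; ⟦mono1⟧ = ≈-refl ; ⟦monoMul⟧ = monomial-*
    ; inv = inv ; inv-0 = ι-0 ; nat*inv = nat*inv }

  open NestedSums (polyRing nv) evaluation public using (step; powers; nested)

  £go-as-foldr : ∀ M S m → £go m S M ≈ foldr (step powers M) (λ _ → 1ₚ) S m
  £go-as-foldr M []            m = ≈-refl
  £go-as-foldr M ((a , k) ∷ S) m = ≈-trans (≈ₚ-reflexive (concatMap≡∑ _ (upTo (M ∸ suc m))))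
    (≈-trans (∑-applyUpTo id (M ∸ suc m) _) (∑<-cong (M ∸ suc m) λ j _ → term j))
    where
    term : ∀ j → let b = suc (m ℕ.+ j) in
           scale (qpow (+ 1 ℚ./ b) k) (monoPow a (suc j)) (£go b S M)
             ≈ monomial a ^ suc j *ₚ (inv b ^ k *ₚ foldr (step powers M) (λ _ → 1ₚ) S b)
    term j = ≈-trans (scale-as-* (qpow (invℚ b) k) (monoPow a (suc j)) (£go b S M))
      (≈-trans (*ₚ-cong (ι-qpow (invℚ b) k) (*ₚ-cong (monomial-^ a (suc j)) (£go-as-foldr M S b)))
        (swap (inv b ^ k) (monomial a ^ suc j) _))
      where
      b = suc (m ℕ.+ j)
      swap : ∀ P Q S → P *ₚ (Q *ₚ S) ≈ Q *ₚ (P *ₚ S)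
      swap P Q S = ≈-trans (≈-sym (*ₚ-assoc P Q S)) (≈-trans (*-congʳ {x = S} (*ₚ-comm P Q)) (*ₚ-assoc Q P S))

  £<-as-nested : ∀ M S → £< M S ≈ nested M S
  £<-as-nested M S = £go-as-foldr M S 0

module PolyIntegrality {nv p : ℕ} (pr : Prime p) where
  open Integral pr
  open PolyConstants nv using (ι; ⟨⟩-ι*)

  -- Stated through pairings, since the listed coefficients are no invariant: denominators may
  -- cancel between equal monomials that have not been collected. Closure under products is then an
  -- iterated pairing.
  IntegralPoly : Poly nv → Set
  IntegralPoly P = ∀ φ → (∀ μ → p-integral (φ μ)) → p-integral ⟨ φ , P ⟩

  p-integral-0 : p-integral 0ℚ
  p-integral-0 = ∤1

  p-integral-1 : p-integral 1ℚ
  p-integral-1 = ∤1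

  integral-resp : ∀ {P Q} → P ≈ₚ Q → IntegralPoly P → IntegralPoly Q
  integral-resp e i φ iφ = subst p-integral (e .at φ) (i φ iφ)

  integral-0 : IntegralPoly []
  integral-0 φ iφ = p-integral-0

  integral-monomial : ∀ c a → p-integral c → IntegralPoly [ (c , a) ]
  integral-monomial c a ic φ iφ =
    subst p-integral (sym (⟨⟩-monomial φ c a)) (p-integral-* {c} {φ a} ic (iφ a))

  integral-+ : ∀ {P Q} → IntegralPoly P → IntegralPoly Q → IntegralPoly (P ++ Q)
  integral-+ {P} {Q} i j φ iφ =
    subst p-integral (sym (⟨⟩-++ φ P Q)) (p-integral-+ {⟨ φ , P ⟩} {⟨ φ , Q ⟩} (i φ iφ) (j φ iφ))

  integral-* : ∀ {P Q} → IntegralPoly P → IntegralPoly Q → IntegralPoly (P *ₚ Q)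
  integral-* {P} {Q} i j φ iφ =
    subst p-integral (sym (⟨⟩-*ₚ φ P Q)) (i _ λ μ → j _ λ ν → iφ (monoMul μ ν))

  integral-neg : ∀ {P} → IntegralPoly P → IntegralPoly (negₚ P)
  integral-neg {P} i φ iφ =
    subst p-integral (sym (⟨⟩-neg φ P)) (p-integral-neg {⟨ φ , P ⟩} (i φ iφ))

  integralElements : IntegralElements (polyRing nv)
  integralElements = record
    { Int      = IntegralPoly
    ; Int-resp = λ {P} {Q} → integral-resp {P} {Q}
    ; Int-0    = integral-0
    ; Int-1    = integral-monomial 1ℚ mono1 p-integral-1
    ; Int-+    = λ {P} {Q} → integral-+ {P} {Q}
    ; Int-*    = λ {P} {Q} → integral-* {P} {Q}
    ; Int-neg  = λ {P} → integral-neg {P} }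

  indicator-integral : ∀ (μ ν : Mono nv) → p-integral (indicator μ ν)
  indicator-integral μ ν with Vec.≡-dec ℤ._≟_ ν μ
  ... | yes _ = p-integral-1
  ... | no  _ = p-integral-0

  -- Extracting the coefficient at μ is pairing with an indicator function, whose values 0 and 1 are
  -- integral; the error term thus contributes p^n times a p-integral rational.
  ≈⇒CongPPow : ∀ n P Q {E} → IntegralPoly E → P ≈ₚ Q ++ ι (qpow (fromℕℚ p) n) *ₚ E → CongPPow p n P Q
  ≈⇒CongPPow n P Q {E} iE e μ = subst (InPPow p n) (sym difference) (qpow-InPPow n (iE χ (indicator-integral μ)))
    where
    χ = indicator μ
    q = qpow (fromℕℚ p) n
    cancel : ∀ x y → (x ℚ.+ y) ℚ.- x ≡ y
    cancel = solve 2 (λ x y → (x :+ y) :- x := y) refl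
      where open +-*-Solver
    difference : coeff μ P ℚ.- coeff μ Q ≡ q ℚ.* ⟨ χ , E ⟩
    difference = begin
      coeff μ P ℚ.- coeff μ Q                            ≡⟨ cong₂ ℚ._-_ (coeff-as-⟨⟩ μ P) (coeff-as-⟨⟩ μ Q) ⟩
      ⟨ χ , P ⟩ ℚ.- ⟨ χ , Q ⟩                            ≡⟨ cong (ℚ._- ⟨ χ , Q ⟩) (trans (e .at χ) (⟨⟩-++ χ Q (ι q *ₚ E))) ⟩
      (⟨ χ , Q ⟩ ℚ.+ ⟨ χ , ι q *ₚ E ⟩) ℚ.- ⟨ χ , Q ⟩     ≡⟨ cancel ⟨ χ , Q ⟩ ⟨ χ , ι q *ₚ E ⟩ ⟩
      ⟨ χ , ι q *ₚ E ⟩                                   ≡⟨ ⟨⟩-ι* χ q E ⟩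
      q ℚ.* ⟨ χ , E ⟩                                    ∎
      where open ≡.≡-Reasoning

-- Specialisation to polynomials and conclusion

module Assembly (r' s' M : ℕ) (pr : Prime (suc M)) where
  private
    R = polyRing (nv r' s')
    p = suc M
  open CommutativeRing R using (_≈_)
    renaming (refl to ≈-refl; trans to ≈-trans; sym to ≈-sym)
  open Sequences R
  open PolyConstants (nv r' s')
  open Integral pr
  open PolyIntegrality {nv r' s'} pr
  private
    nat-p-integral : IntegralPoly (nat p)
    nat-p-integral = integral-resp (ι-nat p) (integral-monomial (fromℕℚ p) mono1 (p-integral-fromℕℚ p))

  open Congruence R integralElements (nat p) nat-p-integral
  open ShuffleCongruence R evaluation integralElements (λ a → integral-monomial 1ℚ a p-integral-1)
    M (λ b b<p → integral-monomial (invℚ (suc b)) mono1 (p-integral-invℚ b b<p)) nat-p-integral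
    using (shuffle-≋)

  ι-binomials : ∀ {s} (l : Fin s → ℕ) (fs : Vec ℕ s) →
    ι (Vec.foldr _ ℚ._*_ 1ℚ (Vec.tabulate (λ i → fromℕℚ ([l+f∸1]Cf (l i) (Vec.lookup fs i)))))
      ≈ binomials (Vec.tabulate l) fs
  ι-binomials l []       = ≈-refl
  ι-binomials l (f ∷ fs) = ≈-trans (ι-* (fromℕℚ ([l+f∸1]Cf (l Fin.zero) f)) _)
    (*ₚ-cong (ι-nat ([l+f∸1]Cf (l Fin.zero) f)) (ι-binomials (l ∘ Fin.suc) fs))

  LHS-as-∑ : ∀ k l n → LHS r' s' k l p n ≈ ∑ (shuffleS (symX r' s' k) (symY r' s' l)) (nested p)
  LHS-as-∑ k l n = ≈-trans (≈ₚ-reflexive (concatMap≡∑ (£< p) (shuffleS (symX r' s' k) (symY r' s' l))))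
    (∑-cong (shuffleS (symX r' s' k) (symY r' s' l)) (£<-as-nested p))

  module _ (k : Fin (suc r') → ℕ) (l : Fin (suc s') → ℕ) (n : ℕ) where

    y₁ : Mono (nv r' s')
    y₁ = yv r' s' Fin.zero

    ls : Vec ℕ (suc s')
    ls = Vec.tabulate l

    fss : List (Vec ℕ (suc s'))
    fss = box r' s' (suc s') n

    tail : Vec ℕ (suc s') → Poly (nv r' s')
    tail fs = nested p (twist (y₁⁻¹ r' s') (symX r' s' k ++ reverse (zipSymY r' s' l fs)))

    RHS-as-∑ : RHS r' s' k l p n ≈ ∑ fss (λ fs → coefficients ls fs *ₚ (monomial y₁ ^ p *ₚ tail fs))
    RHS-as-∑ = ≈-trans (scale-as-* (signℚ (total ls)) (monoPow y₁ p) (concatMap term fss))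
      (≈-trans (*ₚ-cong (ι-sign (total ls)) (*ₚ-cong (monomial-^ y₁ p)
        (≈-trans (≈ₚ-reflexive (concatMap≡∑ term fss)) (∑-cong fss term≈))))
      (≈-trans (collect-scalars fss (negₚ 1ₚ ^ total ls) (monomial y₁ ^ p)
                 (binomials ls) (λ fs → nat p ^ total fs) tail)
        (∑-cong fss λ fs → *ₚ-cong (≈-sym (coefficients-total ls fs)) ≈-refl)))
      where
      term : Vec ℕ (suc s') → Poly (nv r' s')
      term fs = scale (binomProd r' s' l (Vec.lookup fs) ℚ.* qpow (fromℕℚ p) (sumℕ r' s' fs)) mono1
                      (£< p (symRHS r' s' k l (Vec.lookup fs)))
      term≈ : ∀ fs → term fs ≈ (binomials ls fs *ₚ nat p ^ total fs) *ₚ (1ₚ *ₚ tail fs)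
      term≈ fs = ≈-trans (scale-as-* (b ℚ.* q) mono1 _)
        (*ₚ-cong (≈-trans (ι-* b q) (*ₚ-cong (ι-binomials l fs)
                   (≈-trans (ι-qpow (fromℕℚ p) (total fs)) (^-congˡ (total fs) (ι-nat p)))))
          (*ₚ-cong (≈-refl {1ₚ})
            (≈-trans (£<-as-nested p (symRHS r' s' k l (Vec.lookup fs)))
                     (≈ₚ-reflexive (cong (nested p) (symRHS-as-twist r' s' k l fs))))))
        where
        b = binomProd r' s' l (Vec.lookup fs)
        q = qpow (fromℕℚ p) (total fs)

    shuffle-≋-RHS : (∀ i → 1 ≤ k i) → (∀ j → 1 ≤ l j) →
      ∑ (shuffleS (symX r' s' k) (symY r' s' l)) (nested p)
        ≋[ n ] ∑ fss (λ fs → coefficients ls fs *ₚ (monomial y₁ ^ p *ₚ tail fs))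
    shuffle-≋-RHS k≥1 l≥1 = shuffle-≋ r' s' n
      (xv r' s' Fin.zero , k Fin.zero) (List.tabulate (λ i → xv r' s' (Fin.suc i) , k (Fin.suc i)))
      y₁ (l Fin.zero) (List.tabulate (λ j → yv r' s' (Fin.suc j) , l (Fin.suc j)))
      (y₁⁻¹ r' s')
      (≈-trans (≈-sym (monomial-* (y₁⁻¹ r' s') y₁)) (≈ₚ-reflexive (cong monomial (monoMul-inverseˡ y₁))))
      (All.tabulate⁺ {f = λ i → xv r' s' i , k i} k≥1) (All.tabulate⁺ {f = λ j → yv r' s' j , l j} l≥1)
      (Vec.tabulate (yv r' s' ∘ Fin.suc) Vec.∷ʳ mono1) ls
      (shift-tabulate (yv r' s' ∘ Fin.suc) l)

    congruence : (∀ i → 1 ≤ k i) → (∀ j → 1 ≤ l j) → CongPPow p n (LHS r' s' k l p n) (RHS r' s' k l p n)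
    congruence k≥1 l≥1 = let _ , E , iE , eq = shuffle-≋-RHS k≥1 l≥1 in
      ≈⇒CongPPow n (LHS r' s' k l p n) (RHS r' s' k l p n) {E} iE
        (≈-trans (LHS-as-∑ k l n) (≈-trans eq (++-congₚ (≈-sym RHS-as-∑)
          (*ₚ-cong {Q = E} (≈-trans (^-congˡ n (≈-sym (ι-nat p))) (≈-sym (ι-qpow (fromℕℚ p) n))) ≈-refl))))

theorem4p9 : (N : ℕ) .{{_ : NonZero N}} (α : Fin N) (r' s' : ℕ)
    (k : Fin (suc r') → ℕ) (l : Fin (suc s') → ℕ) →
    (∀ i → 1 ≤ k i) → (∀ j → 1 ≤ l j) →
    EqÂ N α (LHS r' s' k l) (RHS r' s' k l)
-- The bound 0 will do, because the congruence holds at every prime.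
theorem4p9 N α r' s' k l k≥1 l≥1 n = 0 , λ where
  (suc M) pr _ _ → Assembly.congruence r' s' M pr k l n k≥1 l≥1
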